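{- For every instance of Safe Bicycle Network with Bounded Detours (SBNBD) whose input graph is a tree, a minimum-cost solution, i.e. a set $F\subseteq E_u$ of minimum cost $c(F)$ such that for every terminal pair $\{s_i,t_i\}$ there is a safe $s_i$-$t_i$ path in $G\langle F\rangle$ of detour factor at most $\alpha$, can be computed in polynomial time. Thus, SBNBD is polynomial-time solvable on trees.
   Context: $\mathbb{N}$ denotes the positive integers, $\mathbb{N}_0=\mathbb{N}\cup\{0\}$, and $\mathbb{Q}_{\ge 1}$ the rationals that are at least one. A network is a finite simple undirected graph $G=(V,E)$ whose edge set is partitioned as $E=E_s\uplus E_u$ into safe edges $E_s$ and unsafe edges $E_u$, together with edge lengths $\theta\colon E\to\mathbb{N}$ and upgrade costs $c\colon E_u\to\mathbb{N}$. The length $\mathrm{len}(P)$ of a path $P$ is the sum of $\theta(e)$ over its edges; $\mathrm{dist}(s,t)=\mathrm{dist}_G(s,t)$ is the minimum length of an $s$-$t$ path in $G$ (using safe or unsafe edges). The detour factor of an $s$-$t$ path $P$ in $G$ is $\mathrm{len}(P)/\mathrm{dist}(s,t)$. A path is safe if all its edges are safe. For $F\subseteq E_u$, $G\langle F\rangle$ is the network $G$ with safe edges $E_s\cup F$ and unsafe edges $E_u\setminus F$. SBNBD: given a network $G=(V,E=E_s\uplus E_u,c,\theta)$, a set $\mathcal{P}=\{\{s_i,t_i\}\mid 1\le i\le p\}$ of $p\in\mathbb{N}$ terminal pairs (each consisting of two distinct vertices of $V$), a budget $k\in\mathbb{N}_0$ and a number $\alpha\in\mathbb{Q}_{\ge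 1}$, decide whether there is a solution, i.e. a set $F\subseteq E_u$ with $c(F)=\sum_{e\in F}c(e)\le k$ such that for each $i\in\{1,\dots,p\}$ there is a safe $s_i$-$t_i$ path in $G\langle F\rangle$ of detour factor at most $\alpha$. -}

module Defs where

open import Data.Bool using (Bool; true; false; if_then_else_)
open import Data.Fin as Fin using (Fin; toℕ)
open import Data.Fin.Subset using (Subset; _∈_; _⊆_; ∁)
open import Data.Integer using (+_; ∣_∣)
open import Data.List as List using (List; []; _∷_; length)
open import Data.List.Relation.Unary.All using (All)
open import Data.List.Relation.Unary.Unique.Propositional using (Unique)
open import Data.Nat using (ℕ; zero; suc; _+_; _*_; _^_; _≤_; NonZero)
open import Data.Nat.Binary as ℕᵇ using (ℕᵇ; 2[1+_]; 1+[2_])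
open import Data.Nat.ListAction using (sum)
open import Data.Product using (Σ; ∃; ∃-syntax; _×_; _,_; proj₁)
open import Data.Rational as ℚ using (ℚ; 1ℚ; ↥_; ↧ₙ_)
open import Data.Sum using (_⊎_)
open import Data.Vec as Vec using (Vec; lookup; _[_]≔_)
open import Function.Definitions using (Injective)
open import Relation.Binary.Construct.Closure.ReflexiveTransitive using (Star; ε; _◅_)
open import Relation.Binary.PropositionalEquality using (_≡_)
open import Relation.Nullary using (¬_; Reflects)

------------------------------------------------------------------------
-- Graphs

-- Two-element subsets {u , v} of Fin n: listing the smaller element
-- first represents each of them exactly once.
record Pair (n : ℕ) : Set where
  constructor pair
  field
    fst snd  : Fin n
    .ordered : fst Fin.< snd

record Graph : Set where
  field
    n m    : ℕ
    ends   : Fin m → Pair n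
    simple : Injective _≡_ _≡_ ends

  V E : Set
  V = Fin n
  E = Fin m

  Joins : E → V → V → Set
  Joins e u v = (fst ≡ u × snd ≡ v) ⊎ (fst ≡ v × snd ≡ u)
    where open Pair (ends e)

  Adj : V → V → Set
  Adj u v = ∃[ e ] Joins e u v

  Walk : V → V → Set
  Walk = Star Adj

  vertices : ∀ {u v} → Walk u v → List V
  vertices {u} ε       = u ∷ []
  vertices {u} (_ ◅ w) = u ∷ vertices w

  edges : ∀ {u v} → Walk u v → List E
  edges ε             = []
  edges ((e , _) ◅ w) = e ∷ edges w

  Path : V → V → Set
  Path u v = Σ (Walk u v) λ w → Unique (vertices w)

  Connected : Set
  Connected = ∀ u v → Path u v

  -- A cycle is a path on at least three vertices whose last vertex is
  -- adjacent to its first.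
  Acyclic : Set
  Acyclic = ∀ {u v} (P : Path u v) → 3 ≤ length (vertices (proj₁ P)) → ¬ Adj v u

  record IsTree : Set where
    field
      nonempty  : NonZero n
      connected : Connected
      acyclic   : Acyclic

------------------------------------------------------------------------
-- Networks

-- Only unsafe edges carry an upgrade cost.
data Kind : Set where
  safe   : Kind
  unsafe : (cost : ℕ) → .{{NonZero cost}} → Kind

isSafe : Kind → Bool
isSafe safe       = true
isSafe (unsafe _) = false

costOf : Kind → ℕ
costOf safe       = 0
costOf (unsafe c) = c

record Network : Set where
  field
    graph : Graph
  open Graph graph public
  field
    kind       : E → Kind
    θ          : E → ℕ
    θ-positive : ∀ e → NonZero (θ e)

  Eₛ Eᵤ : Subset m
  Eₛ = Vec.tabulate λ e → isSafe (kind e)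
  Eᵤ = ∁ Eₛ

  len : ∀ {s t} → Path s t → ℕ
  len (w , _) = sum (List.map θ (edges w))

  IsDist : V → V → ℕ → Set
  IsDist s t d = (Σ (Path s t) λ P → len P ≡ d) × (∀ (P : Path s t) → d ≤ len P)

  -- len P / dist s t ≤ α.  For s ≢ t the distance is positive.
  DetourFactor≤ : ∀ {s t} → Path s t → ℚ → Set
  DetourFactor≤ {s} {t} P α =
    ∃[ d ] Σ (NonZero d) λ d≢0 → IsDist s t d × ((+ len P) ℚ./ d) {{d≢0}} ℚ.≤ α

  IsSafe : ∀ {s t} → Path s t → Set
  IsSafe (w , _) = All (_∈ Eₛ) (edges w)

  -- c(F), for F ⊆ Eᵤ
  cost : Subset m → ℕ
  cost F = Vec.sum (Vec.tabulate λ e → if lookup F e then costOf (kind e) else 0)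

_⟨_⟩ : (G : Network) → Subset (Network.m G) → Network
G ⟨ F ⟩ = record
  { graph      = graph
  ; kind       = λ e → if lookup F e then safe else kind e
  ; θ          = θ
  ; θ-positive = θ-positive
  }
  where open Network G

------------------------------------------------------------------------
-- SBNBD

record Instance : Set where
  field
    network : Network
  open Network network public using (graph; n; m; Eᵤ; cost)
  field
    p          : ℕ
    p-positive : NonZero p
    terminals  : Fin p → Pair n
    distinct   : Injective _≡_ _≡_ terminals
    k          : ℕ
    α          : ℚ
    1≤α        : 1ℚ ℚ.≤ α

  Connects : Subset m → Pair n → Set
  Connects F st = Σ (Path fst snd) λ P → IsSafe P × DetourFactor≤ P α
    where
    open Network (network ⟨ F ⟩)
    open Pair st

  Feasible : Subset m → Set
  Feasible F = F ⊆ Eᵤ × (∀ i → Connects F (terminals i))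

  MinCost : Subset m → Set
  MinCost F = Feasible F × (∀ F′ → Feasible F′ → cost F ≤ cost F′)

  HasSolution : Set
  HasSolution = ∃[ F ] cost F ≤ k × Feasible F

OnTree : Instance → Set
OnTree I = Graph.IsTree (Instance.graph I)

------------------------------------------------------------------------
-- Model of computation: Jones's WHILE language over binary trees with its
-- unit-cost time measure (N. D. Jones, "Computability and Complexity from
-- a Programming Perspective", 1997), where it is shown to define the same
-- class PTIME as Turing machines.

infixr 5 _∙_

data Tree : Set where
  nil : Tree
  _∙_ : Tree → Tree → Tree

size : Tree → ℕ
size nil     = 1
size (x ∙ y) = 1 + size x + size y

head tail : Tree → Tree
head nil     = nil
head (x ∙ y) = x
tail nil     = nil
tail (x ∙ y) = y

data Expr (r : ℕ) : Set where
  var   : Fin r → Expr r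
  nil   : Expr r
  cons  : Expr r → Expr r → Expr r
  hd tl : Expr r → Expr r

infix  6 _≔_
infixr 5 _⨾_

data Cmd (r : ℕ) : Set where
  _≔_   : Fin r → Expr r → Cmd r
  _⨾_   : Cmd r → Cmd r → Cmd r
  cond  : Expr r → Cmd r → Cmd r → Cmd r
  while : Expr r → Cmd r → Cmd r

Store : ℕ → Set
Store r = Vec Tree r

⟦_⟧ : ∀ {r} → Expr r → Store r → Tree
⟦ var x    ⟧ σ = lookup σ x
⟦ nil      ⟧ σ = nil
⟦ cons a b ⟧ σ = ⟦ a ⟧ σ ∙ ⟦ b ⟧ σ
⟦ hd a     ⟧ σ = head (⟦ a ⟧ σ)
⟦ tl a     ⟧ σ = tail (⟦ a ⟧ σ)

exprTime : ∀ {r} → Expr r → ℕ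
exprTime (var x)    = 1
exprTime nil        = 1
exprTime (cons a b) = 1 + exprTime a + exprTime b
exprTime (hd a)     = 1 + exprTime a
exprTime (tl a)     = 1 + exprTime a

-- C ∣ σ ⇓ σ′ [ t ]: started in store σ, command C halts in store σ′
-- after t time units.  The value nil counts as false.
infix 4 _∣_⇓_[_]

data _∣_⇓_[_] {r} : Cmd r → Store r → Store r → ℕ → Set where
  assign : ∀ {x e σ} →
    x ≔ e ∣ σ ⇓ σ [ x ]≔ ⟦ e ⟧ σ [ 1 + exprTime e ]
  seq : ∀ {C D σ σ′ σ″ t t′} →
    C ∣ σ ⇓ σ′ [ t ] → D ∣ σ′ ⇓ σ″ [ t′ ] →
    C ⨾ D ∣ σ ⇓ σ″ [ t + t′ ]
  if-true : ∀ {e C D σ σ′ t a b} →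
    ⟦ e ⟧ σ ≡ a ∙ b → C ∣ σ ⇓ σ′ [ t ] →
    cond e C D ∣ σ ⇓ σ′ [ 1 + exprTime e + t ]
  if-false : ∀ {e C D σ σ′ t} →
    ⟦ e ⟧ σ ≡ nil → D ∣ σ ⇓ σ′ [ t ] →
    cond e C D ∣ σ ⇓ σ′ [ 1 + exprTime e + t ]
  while-true : ∀ {e C σ σ′ σ″ t t′ a b} →
    ⟦ e ⟧ σ ≡ a ∙ b → C ∣ σ ⇓ σ′ [ t ] → while e C ∣ σ′ ⇓ σ″ [ t′ ] →
    while e C ∣ σ ⇓ σ″ [ 1 + exprTime e + t + t′ ]
  while-false : ∀ {e C σ} →
    ⟦ e ⟧ σ ≡ nil →
    while e C ∣ σ ⇓ σ [ 1 + exprTime e ]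

-- Register 0 holds the input at the start and the output at the end.
record Program : Set where
  field
    aux  : ℕ
    body : Cmd (suc aux)

_on_yields_within_ : Program → Tree → Tree → ℕ → Set
P on x yields y within b =
  ∃[ σ ] ∃[ t ] body ∣ x Vec.∷ Vec.replicate aux nil ⇓ σ [ t ] × Vec.head σ ≡ y × t ≤ b
  where open Program P

-- One program and one polynomial serve all inputs satisfying the promise D;
-- R i y says that y is a correct output for input i.
PolyTimeSolvable : {A : Set} (encode : A → Tree) (D : A → Set) (R : A → Tree → Set) → Set
PolyTimeSolvable {A} encode D R =
  Σ Program λ P → ∃[ a ] ∃[ d ] ((i : A) → D i →
    ∃[ y ] R i y × P on encode i yields y within (a * size (encode i) ^ d + a))

------------------------------------------------------------------------
-- Encodings.  Numbers are written in binary (in stdlib's bijective form).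

encBool : Bool → Tree
encBool false = nil
encBool true  = nil ∙ nil

encList : List Tree → Tree
encList = List.foldr _∙_ nil

encBin : ℕᵇ → Tree
encBin ℕᵇ.zero  = nil
encBin 2[1+ b ] = encBool false ∙ encBin b
encBin 1+[2 b ] = encBool true  ∙ encBin b

encℕ : ℕ → Tree
encℕ x = encBin (ℕᵇ.fromℕ x)

encFin : ∀ {n} → Fin n → Tree
encFin i = encℕ (toℕ i)

encPair : ∀ {n} → Pair n → Tree
encPair (pair u v _) = encFin u ∙ encFin v

encKind : Kind → Tree
encKind safe       = nil
encKind (unsafe c) = nil ∙ encℕ c

-- α ≥ 1, so the absolute value of its numerator loses nothing.
encInstance : Instance → Tree
encInstance I = encList
  ( encList (List.tabulate {n = n} encFin)
  ∷ encList (List.tabulate λ e → encPair (ends e) ∙ encKind (kind e) ∙ encℕ (θ e))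
  ∷ encList (List.tabulate λ i → encPair (terminals i))
  ∷ encℕ k
  ∷ (encℕ ∣ ↥ α ∣ ∙ encℕ (↧ₙ α))
  ∷ [])
  where
  open Instance I using (network; terminals; k; α)
  open Network network using (n; ends; kind; θ)

-- One bit per edge, in the order in which encInstance lists the edges.
encSubset : ∀ {m} → Subset m → Tree
encSubset F = encList (List.map encBool (Vec.toList F))

------------------------------------------------------------------------
-- The two computational tasks

MinCostOutput : (I : Instance) → Tree → Set
MinCostOutput I y = ∃[ F ] Instance.MinCost I F × y ≡ encSubset F

DecisionOutput : (I : Instance) → Tree → Set
DecisionOutput I y = ∃[ b ] Reflects (Instance.HasSolution I) b × y ≡ encBool b

{-# OPTIONS --safe #-}

-- In a tree the s-t path is unique, so its detour factor is 1 and a solution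
-- is feasible iff it contains every unsafe edge lying on a path between two
-- terminals of a pair; the set of these edges is the optimum.  An edge e lies
-- on the s-t path iff s and t are in different components of G - e.  Hence it
-- suffices to compute, for every e, a labelling of the vertices by components
-- of G - e, which is done by contracting the edges other than e one by one.
--
-- To obtain WHILE programs for this, a functional language over trees is
-- compiled to WHILE.  All its loops are folds cut off after N steps, where N
-- is the size of the input, so the running time of a term is bounded by a
-- polynomial in N that does not depend on the values computed.

module Submission where

open import Defs
open import Data.Bool using (Bool; true; false; if_then_else_; not; _∧_; _∨_; T)
open import Data.Bool.ListAction using (any)
open import Data.Bool.Properties using (T-≡)
open import Data.Empty using (⊥; ⊥-elim; ⊥-elim-irr)
open import Data.Fin as Fin using (Fin; zero; suc; toℕ)
open import Data.Fin.Patterns using (0F; 1F; 2F; 3F)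
open import Data.Fin.Properties as Fin using (suc-injective; toℕ-injective)
open import Data.Fin.Subset as Subset using (Subset)
open import Data.Fin.Subset.Properties using (x∉p⇒x∈∁p)
import Data.Integer as ℤ
import Data.Integer.Properties as ℤ
open import Data.List as List using (List; []; _∷_; length; reverse; _ʳ++_; allFin)
open import Data.List.Membership.Propositional using (_∈_; find; lose)
open import Data.List.Membership.Propositional.Properties using (∈-allFin; ∈-tabulate⁺)
open import Data.List.Properties
  using (length-map; length-reverse; length-tabulate; map-∘; map-tabulate; reverse-foldl; reverse-involutive)
open import Data.List.Relation.Unary.All as All using (All; []; _∷_)
import Data.List.Relation.Unary.All.Properties as All
open import Data.List.Relation.Unary.AllPairs using ([]; _∷_)
open import Data.List.Relation.Unary.Any as Any using (here; there; any?)
import Data.List.Relation.Unary.Any.Properties as Any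
open import Data.List.Relation.Unary.Unique.Propositional using (Unique)
open import Data.Nat
open import Data.Nat.Binary as ℕᵇ using (ℕᵇ; 2[1+_]; 1+[2_])
import Data.Nat.Binary.Properties as ℕᵇ
open import Data.Nat.ListAction using (sum)
open import Data.Nat.Properties hiding (suc-injective)
open import Data.Nat.Solver using (module +-*-Solver)
open import Data.Product using (∃; ∃-syntax; Σ; _×_; _,_; proj₁; proj₂)
open import Data.Rational as ℚ using (1ℚ)
import Data.Rational.Properties as ℚ
import Data.Rational.Unnormalised as ℚᵘ
open import Data.Sum using (_⊎_; inj₁; inj₂)
open import Data.Vec as Vec using (Vec; []; _∷_; lookup; toList; _[_]≔_)
open import Data.Vec.Properties
  using (lookup∘update; lookup∘update′; lookup-map; lookup∘tabulate; lookup⇒[]=; []=⇒lookup; tabulate-cong)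
open import Data.Vec.Relation.Unary.All as VecAll using ([]; _∷_) renaming (All to VecAll)
open import Function using (flip; _∘_)
open import Function.Bundles using (Equivalence; mk⇔)
open import Relation.Binary.Construct.Closure.ReflexiveTransitive as Star using (Star; ε; _◅_; _◅◅_)
open import Relation.Binary.PropositionalEquality
open import Relation.Nullary using (¬_; yes; no; does; proof; Reflects; ofʸ; ofⁿ; _because_)
open import Relation.Nullary.Decidable using (map′; dec-true; dec-false; does-⇔; _×-dec_)
open import Relation.Nullary.Reflects using (det)

-- A WHILE assignment costs only the size of its expression, whatever the size of the value, and the
-- cut-off makes the number of passes of each fold independent of the data. Hence the time bound
-- needs no analysis of intermediate results. The price is paid in the correctness proof, which must
-- show that the cut-off never bites: every list folded over has length at most N, and every sum of
-- costs is below 2^N. Both hold because edges, terminal pairs and costs are written out in the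
-- input.
--
-- Contraction is a plain fold over the edge list, which a graph search is not. A label is itself a
-- vertex, the representative of its component, so a labelling is a list of redirections no longer
-- than the edge list. Acyclicity enters at one point: a path between the ends of e that avoids e
-- would close a cycle.
--
-- The optimal set calls only for comparisons of vertex numbers. The decision version must also add
-- up costs written in binary, and this is what binary addition is for.

-- A functional language over trees

-- fold l z f folds over at most as many elements of l as the clock ticks; in f,
-- variable 0 is the current element and variable 1 the accumulator.
data Term (Γ : ℕ) : Set where
  var       : Fin Γ → Term Γ
  nil clock : Term Γ
  cons      : Term Γ → Term Γ → Term Γ
  hd tl     : Term Γ → Term Γ
  ite       : Term Γ → Term Γ → Term Γ → Term Γ
  app       : ∀ {k} → Term k → Vec (Term Γ) k → Term Γ
  fold      : Term Γ → Term Γ → Term (2 + Γ) → Term Γ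

unary : ℕ → Tree
unary zero    = nil
unary (suc k) = nil ∙ unary k

branch : {A : Set} → Tree → A → A → A
branch nil     x y = y
branch (_ ∙ _) x y = x

branch-true : {A : Set} {v : Tree} {x y : A} → v ≢ nil → branch v x y ≡ x
branch-true {v = nil}   v≢nil = ⊥-elim (v≢nil refl)
branch-true {v = _ ∙ _} v≢nil = refl

foldTree : ℕ → (Tree → Tree → Tree) → Tree → Tree → Tree
foldTree zero    f _        a = a
foldTree (suc k) f nil      a = a
foldTree (suc k) f (x ∙ xs) a = foldTree k f xs (f x a)

foldTree-nil : ∀ k {g a} → foldTree k g nil a ≡ a
foldTree-nil zero    = refl
foldTree-nil (suc k) = refl

module _ (N : ℕ) where

  eval  : ∀ {Γ} → Term Γ → Vec Tree Γ → Tree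
  evals : ∀ {Γ k} → Vec (Term Γ) k → Vec Tree Γ → Vec Tree k

  eval (var i)      ρ = lookup ρ i
  eval nil          ρ = nil
  eval clock        ρ = unary N
  eval (cons a b)   ρ = eval a ρ ∙ eval b ρ
  eval (hd a)       ρ = head (eval a ρ)
  eval (tl a)       ρ = tail (eval a ρ)
  eval (ite c a b)  ρ = branch (eval c ρ) (eval a ρ) (eval b ρ)
  eval (app f as)   ρ = eval f (evals as ρ)
  eval (fold l z f) ρ = foldTree N (λ x a → eval f (x ∷ a ∷ ρ)) (eval l ρ) (eval z ρ)

  evals []       ρ = []
  evals (a ∷ as) ρ = eval a ρ ∷ evals as ρ

  -- The constants are the costs of the commands emitted by compile below.
  time  : ∀ {Γ} → Term Γ → ℕ
  times : ∀ {Γ k} → Vec (Term Γ) k → ℕ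

  time (var _)      = 2
  time nil          = 2
  time clock        = 2
  time (cons a b)   = time a + (time b + 4)
  time (hd a)       = time a + 3
  time (tl a)       = time a + 3
  time (ite c a b)  = time c + (2 + (time a + time b))
  time (app f as)   = times as + (time f + 2)
  time (fold l z f) = time l + (time z + (2 + ((N * (13 + (time f + 2 + 2)) + 2) + 2)))

  times []       = 2
  times (a ∷ as) = time a + times as

-- The number of scratch registers above the register for the result.
need  : ∀ {Γ} → Term Γ → ℕ
needs : ∀ {Γ k} → Vec (Term Γ) k → ℕ

need (var _)      = 0
need nil          = 0
need clock        = 0
need (cons a b)   = need a ⊔ (1 + need b)
need (hd a)       = need a
need (tl a)       = need a
need (ite c a b)  = need c ⊔ (need a ⊔ need b)
need (app {k} f as) = needs as ⊔ (k + need f)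
need (fold l z f) = need l ⊔ ((1 + need z) ⊔ (4 + need f))

needs []       = 0
needs (a ∷ as) = need a ⊔ (1 + needs as)

-- Compilation to WHILE

-- Truncating: indices beyond M all denote the last register.
reg : ∀ {M} → ℕ → Fin (suc M)
reg         zero    = zero
reg {zero}  (suc i) = zero
reg {suc M} (suc i) = suc (reg i)

reg-injective : ∀ {M i j} → i ≤ M → j ≤ M → reg {M} i ≡ reg j → i ≡ j
reg-injective {zero} z≤n z≤n _ = refl
reg-injective {suc M} {zero}  {zero}  _ _ _ = refl
reg-injective {suc M} {suc i} {suc j} (s≤s p) (s≤s q) e =
  cong suc (reg-injective p q (suc-injective e))

infix 6 _‼_
_‼_ : ∀ {M} → Store (suc M) → ℕ → Tree
σ ‼ i = lookup σ (reg i)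

‼-write : ∀ {M} (σ : Store (suc M)) i {v} → (σ [ reg i ]≔ v) ‼ i ≡ v
‼-write σ i = lookup∘update (reg i) σ _

‼-other : ∀ {M} (σ : Store (suc M)) {i j v} → i ≤ M → j ≤ M → j ≢ i → (σ [ reg i ]≔ v) ‼ j ≡ σ ‼ j
‼-other σ i≤M j≤M j≢i = lookup∘update′ (λ e → j≢i (reg-injective j≤M i≤M e)) σ _

‼-frame : ∀ {M} (σ : Store (suc M)) {i j v} → i ≤ M → j < i → (σ [ reg i ]≔ v) ‼ j ≡ σ ‼ j
‼-frame σ i≤M j<i = ‼-other σ i≤M (≤-trans (<⇒≤ j<i) i≤M) (<⇒≢ j<i)

‼-above : ∀ {M} (σ : Store (suc M)) {i j v} → j ≤ M → i < j → (σ [ reg i ]≔ v) ‼ j ≡ σ ‼ j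
‼-above σ j≤M i<j = ‼-other σ (≤-trans (<⇒≤ i<j) j≤M) j≤M (>⇒≢ i<j)

-- Total correctness of WHILE commands with time bounds

record Reaches {r} (C : Cmd r) (σ : Store r) (T : ℕ) (Q : Store r → Set) : Set where
  constructor reaches
  field
    {final} : Store r
    {spent} : ℕ
    run     : C ∣ σ ⇓ final [ spent ]
    bound   : spent ≤ T
    holds   : Q final

module _ {r : ℕ} {σ : Store r} where

  by-assign : ∀ {x e Q} → Q (σ [ x ]≔ ⟦ e ⟧ σ) → Reaches (x ≔ e) σ (1 + exprTime e) Q
  by-assign q = reaches assign ≤-refl q

  -- The postcondition fixes the whole store, so matching on `refl` lets the rest of a command be
  -- treated in an explicit store.
  by-write : ∀ {x e} v → ⟦ e ⟧ σ ≡ v → Reaches (x ≔ e) σ (1 + exprTime e) (_≡ σ [ x ]≔ v)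
  by-write _ refl = by-assign refl

  by-seq : ∀ {C D T U P Q} → Reaches C σ T P → (∀ {σ′} → P σ′ → Reaches D σ′ U Q) →
           Reaches (C ⨾ D) σ (T + U) Q
  by-seq (reaches c b p) k with k p
  ... | reaches d b′ q = reaches (seq c d) (+-mono-≤ b b′) q

  -- Both branches are charged. The sum stands in for the maximum, which keeps `time` built from
  -- sums and products, the operations under which `Polynomial` is shown to be closed.
  by-cond : ∀ {e C D T U Q} v → ⟦ e ⟧ σ ≡ v →
            (v ≢ nil → Reaches C σ T Q) → (v ≡ nil → Reaches D σ U Q) →
            Reaches (cond e C D) σ (1 + exprTime e + (T + U)) Q
  by-cond {e} {T = T} {U} nil p _ k with k refl
  ... | reaches d b q = reaches (if-false p d) (+-monoʳ-≤ (1 + exprTime e) (≤-trans b (m≤n+m U T))) q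
  by-cond {e} {T = T} {U} (_ ∙ _) p k _ with k (λ ())
  ... | reaches d b q = reaches (if-true p d) (+-monoʳ-≤ (1 + exprTime e) (≤-trans b (m≤m+n T U))) q

  weaken : ∀ {C T U P Q} → T ≤ U → (∀ {σ′} → P σ′ → Q σ′) → Reaches C σ T P → Reaches C σ U Q
  weaken T≤U P⊆Q (reaches c b p) = reaches c (≤-trans b T≤U) (P⊆Q p)

module Compiler {M : ℕ} where

  registersFrom : ℕ → ∀ k → Vec ℕ k
  registersFrom h zero    = []
  registersFrom h (suc k) = h ∷ registersFrom (suc h) k

  read : ℕ → Expr (suc M)
  read i = var (reg i)

  -- The variables are in the registers ρ and the clock is in register 1; the
  -- value is left in register h and the registers below h are preserved.
  compile  : ∀ {Γ} → Term Γ → Vec ℕ Γ → ℕ → Cmd (suc M)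
  compiles : ∀ {Γ k} → Vec (Term Γ) k → Vec ℕ Γ → ℕ → Cmd (suc M)
  foldStep : ∀ {Γ} → Term (2 + Γ) → Vec ℕ Γ → ℕ → Cmd (suc M)

  compile (var i)      ρ h = reg h ≔ read (lookup ρ i)
  compile nil          ρ h = reg h ≔ nil
  compile clock        ρ h = reg h ≔ read 1
  compile (cons a b)   ρ h = compile a ρ h ⨾ compile b ρ (1 + h) ⨾ reg h ≔ cons (read h) (read (1 + h))
  compile (hd a)       ρ h = compile a ρ h ⨾ reg h ≔ hd (read h)
  compile (tl a)       ρ h = compile a ρ h ⨾ reg h ≔ tl (read h)
  compile (ite c a b)  ρ h = compile c ρ h ⨾ cond (read h) (compile a ρ h) (compile b ρ h)
  compile (app {k} f as) ρ h =
    compiles as ρ h ⨾ compile f (registersFrom h k) (k + h) ⨾ reg h ≔ read (k + h)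
  -- The registers from `h` on hold the rest of the list, the accumulator, the ticks left, the
  -- current element and the value of `f`.
  compile (fold l z f) ρ h =
    compile l ρ h ⨾ compile z ρ (1 + h) ⨾ reg (2 + h) ≔ read 1 ⨾
    while (read (2 + h)) (foldStep f ρ h) ⨾ reg h ≔ read (1 + h)

  -- WHILE has no skip command. Register `h` lies above the arguments already computed and is free,
  -- so clearing it does no harm.
  compiles []       ρ h = reg h ≔ nil
  compiles (a ∷ as) ρ h = compile a ρ h ⨾ compiles as ρ (1 + h)

  foldStep f ρ h =
    reg (2 + h) ≔ tl (read (2 + h)) ⨾
    cond (read h)
      (reg (3 + h) ≔ hd (read h) ⨾ reg h ≔ tl (read h) ⨾
       compile f (3 + h ∷ 1 + h ∷ ρ) (4 + h) ⨾ reg (1 + h) ≔ read (4 + h))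
      -- A self-assignment in place of skip: the list is exhausted and only the counter still runs.
      (reg (1 + h) ≔ read (1 + h))

  -- Correctness of compilation

  record Frame (h : ℕ) (σ σ′ : Store (suc M)) : Set where
    constructor framed
    field
      preserves : ∀ {j} → j < h → σ′ ‼ j ≡ σ ‼ j
  open Frame

  Result : ℕ → Tree → Store (suc M) → Store (suc M) → Set
  Result h v σ σ′ = σ′ ‼ h ≡ v × Frame h σ σ′

  frame-refl : ∀ {h σ} → Frame h σ σ
  frame-refl = framed λ _ → refl

  frame-trans : ∀ {h h′ σ σ′ σ″} → h ≤ h′ → Frame h σ σ′ → Frame h′ σ′ σ″ → Frame h σ σ″
  frame-trans h≤h′ f g = framed λ j<h → trans (preserves g (≤-trans j<h h≤h′)) (preserves f j<h)

  frame-write : ∀ {h i v σ σ′} → h ≤ i → i ≤ M → Frame h σ σ′ → Frame h σ (σ′ [ reg i ]≔ v)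
  frame-write {σ′ = σ′} h≤i i≤M f = frame-trans h≤i f (framed (‼-frame σ′ i≤M))

  read-all : Store (suc M) → ∀ {k} → Vec ℕ k → Vec Tree k
  read-all σ = Vec.map (σ ‼_)

  read-all-frame : ∀ {h σ σ′ k} {ρ : Vec ℕ k} → VecAll (_< h) ρ → Frame h σ σ′ →
                   read-all σ′ ρ ≡ read-all σ ρ
  read-all-frame []       fr = refl
  read-all-frame (p ∷ ps) fr = cong₂ _∷_ (preserves fr p) (read-all-frame ps fr)

  registersFrom-bounded : ∀ h k → VecAll (_< k + h) (registersFrom h k)
  registersFrom-bounded h zero    = []
  registersFrom-bounded h (suc k) =
    s≤s (m≤n+m h k) ∷
    subst (λ b → VecAll (_< b) (registersFrom (suc h) k)) (+-suc k h) (registersFrom-bounded (suc h) k)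

  bounded-up : ∀ {h h′ k} {ρ : Vec ℕ k} → h ≤ h′ → VecAll (_< h) ρ → VecAll (_< h′) ρ
  bounded-up h≤h′ = VecAll.map (λ p → ≤-trans p h≤h′)

  fits-left : ∀ h {a b} → h + (a ⊔ b) ≤ M → h + a ≤ M
  fits-left h {a} {b} = ≤-trans (+-monoʳ-≤ h (m≤m⊔n a b))

  fits-right : ∀ h a {b} → h + (a ⊔ b) ≤ M → h + b ≤ M
  fits-right h a {b} = ≤-trans (+-monoʳ-≤ h (m≤n⊔m a b))

  fits-shift : ∀ h k {a} → h + (k + a) ≤ M → (k + h) + a ≤ M
  fits-shift h k {a} = subst (_≤ M) (trans (sym (+-assoc h k a)) (cong (_+ a) (+-comm h k)))

  fits : ∀ {h a} → h + a ≤ M → h ≤ M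
  fits = ≤-trans (m≤m+n _ _)

  module _ (N : ℕ) where

    -- `1 < h` puts the input and the clock below the frame, so that both survive every subcommand.
    -- The bound by `M` keeps the truncation in `reg` from identifying registers in use.
    Correct : ∀ {Γ} → Term Γ → Set
    Correct t = ∀ {ρ h σ} → h + need t ≤ M → 1 < h → VecAll (_< h) ρ → σ ‼ 1 ≡ unary N →
      Reaches (compile t ρ h) σ (time N t) (Result h (eval N t (read-all σ ρ)) σ)

    module Loop {Γ} (f : Term (2 + Γ)) (f-correct : Correct f) {ρ : Vec ℕ Γ} {h} {σ₀ : Store (suc M)}
                (fit : (4 + h) + need f ≤ M) (1<h : 1 < h) (ρ<h : VecAll (_< h) ρ)
                (ticks : σ₀ ‼ 1 ≡ unary N) where

      h≤4+h : h ≤ 4 + h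
      h≤4+h = m≤n+m h 4

      in4 : 4 + h ≤ M
      in4 = fits fit

      in3 : 3 + h ≤ M
      in3 = ≤-trans (n≤1+n _) in4

      in2 : 2 + h ≤ M
      in2 = ≤-trans (n≤1+n _) in3

      in1 : 1 + h ≤ M
      in1 = ≤-trans (n≤1+n _) in2

      g : Tree → Tree → Tree
      g x a = eval N f (x ∷ a ∷ read-all σ₀ ρ)

      -- The loop invariant as a conservation law: the value that the remaining ticks will compute
      -- from list and accumulator stays the same. It covers the idle passes too, where both sides
      -- are the accumulator.
      Step : ℕ → Store (suc M) → Store (suc M) → Set
      Step k σ σ′ = Frame h σ₀ σ′ × σ′ ‼ (2 + h) ≡ unary k ×
        foldTree k g (σ′ ‼ h) (σ′ ‼ (1 + h)) ≡ foldTree (suc k) g (σ ‼ h) (σ ‼ (1 + h))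

      -- 11 consists of 3 for the counter, 2 for the test of the list, 3 for taking the element and
      -- 3 for advancing the list. The two further 2s are the copy of the value of `f` and the idle
      -- branch, which `by-cond` charges as well.
      step : ∀ {σ k} → Frame h σ₀ σ → σ ‼ (2 + h) ≡ unary (suc k) →
             Reaches (foldStep f ρ h) σ (11 + (time N f + 2 + 2)) (Step k σ)
      step {σ} {k} fr cnt =
          by-seq (by-write (unary k) (cong tail cnt)) λ { refl →
            by-cond (σ ‼ h) (‼-frame σ in2 (m≤n+m _ 1)) consume skip }
        where
        σ₁ = σ [ reg (2 + h) ]≔ unary k
        fr₁ : Frame h σ₀ σ₁
        fr₁ = frame-write (m≤n+m h 2) in2 fr
        element : σ₁ ‼ h ≡ σ ‼ h
        element = ‼-frame σ in2 (m≤n+m _ 1)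
        accumulator : σ₁ ‼ (1 + h) ≡ σ ‼ (1 + h)
        accumulator = ‼-frame σ in2 ≤-refl

        skip : σ ‼ h ≡ nil → Reaches (reg (1 + h) ≔ read (1 + h)) σ₁ 2 (Step k σ)
        skip x≡nil = by-assign
          ( frame-write (n≤1+n h) in1 fr₁
          , trans (‼-above σ₁ in2 ≤-refl) (‼-write σ (2 + h))
          , (begin
              foldTree k g (σ₂ ‼ h) (σ₂ ‼ (1 + h))
                ≡⟨ cong (λ x → foldTree k g x (σ₂ ‼ (1 + h))) (trans (‼-frame σ₁ in1 ≤-refl) (trans element x≡nil)) ⟩
              foldTree k g nil (σ₂ ‼ (1 + h))
                ≡⟨ foldTree-nil k ⟩
              σ₂ ‼ (1 + h)
                ≡⟨ trans (‼-write σ₁ (1 + h)) accumulator ⟩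
              foldTree (suc k) g nil (σ ‼ (1 + h))
                ≡⟨ cong (λ x → foldTree (suc k) g x (σ ‼ (1 + h))) (sym x≡nil) ⟩
              foldTree (suc k) g (σ ‼ h) (σ ‼ (1 + h)) ∎))
          where
          open ≡-Reasoning
          σ₂ = σ₁ [ reg (1 + h) ]≔ (σ₁ ‼ (1 + h))

        consume : σ ‼ h ≢ nil → Reaches (reg (3 + h) ≔ hd (read h) ⨾ reg h ≔ tl (read h) ⨾
                    compile f (3 + h ∷ 1 + h ∷ ρ) (4 + h) ⨾ reg (1 + h) ≔ read (4 + h)) σ₁
                    (3 + (3 + (time N f + 2))) (Step k σ)
        consume x≢nil with σ ‼ h in x-eq
        ... | nil    = ⊥-elim (x≢nil refl)
        ... | y ∙ ys =
          by-seq (by-write y (cong head (trans element x-eq))) λ { refl →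
          by-seq (by-write ys (cong tail (trans (‼-frame σ₁ in3 (m≤n+m _ 2)) (trans element x-eq)))) λ { refl →
          by-seq (f-correct fit (≤-trans 1<h h≤4+h)
                    (m≤n+m _ 0 ∷ m≤n+m _ 2 ∷ bounded-up h≤4+h ρ<h)
                    (trans (preserves fr₃ 1<h) ticks)) λ { {σ₄} (value , frame) →
          by-assign
            ( frame-write (n≤1+n h) in1 (frame-trans h≤4+h fr₃ frame)
            , (trans (‼-above σ₄ in2 ≤-refl) (trans (preserves frame (m≤n+m _ 1))
                (trans (‼-above σ₂ in2 (m≤n+m _ 1)) (trans (‼-frame σ₁ in3 ≤-refl) (‼-write σ (2 + h))))))
            , cong₂ (foldTree k g)
                (trans (‼-frame σ₄ in1 ≤-refl) (trans (preserves frame (m≤n+m _ 3)) (‼-write σ₂ h)))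
                (trans (‼-write σ₄ (1 + h)) (trans value (cong (eval N f) (cong₂ _∷_
                  (trans (‼-above σ₂ in3 (m≤n+m _ 2)) (‼-write σ₁ (3 + h)))
                  (cong₂ _∷_ accumulator₃ (read-all-frame ρ<h fr₃)))))) ) } } }
          where
          σ₂ = σ₁ [ reg (3 + h) ]≔ y
          σ₃ = σ₂ [ reg h ]≔ ys
          fr₃ : Frame h σ₀ σ₃
          fr₃ = frame-write ≤-refl (fits {a = 4 + need f} (subst (_≤ M) shift fit))
                  (frame-write (m≤n+m h 3) in3 fr₁)
            where
            shift : 4 + h + need f ≡ h + (4 + need f)
            shift = trans (cong (_+ need f) (+-comm 4 h)) (+-assoc h 4 (need f))
          accumulator₃ : σ₃ ‼ (1 + h) ≡ σ ‼ (1 + h)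
          accumulator₃ = trans (‼-above σ₂ in1 ≤-refl) (trans (‼-frame σ₁ in3 (m≤n+m _ 1)) accumulator)

      -- Induction on the ticks and not on the list: the loop ends when the counter is empty, hence
      -- after exactly `k` passes whatever the data. 13 is the 11 of `step` plus 2 for the loop
      -- test.
      loop : ∀ k {σ} → Frame h σ₀ σ → σ ‼ (2 + h) ≡ unary k →
             Reaches (while (read (2 + h)) (foldStep f ρ h)) σ (k * (13 + (time N f + 2 + 2)) + 2)
               (λ σ′ → σ′ ‼ (1 + h) ≡ foldTree k g (σ ‼ h) (σ ‼ (1 + h)) × Frame h σ₀ σ′)
      loop zero    fr cnt = reaches (while-false cnt) ≤-refl (refl , fr)
      loop (suc k) fr cnt with step fr cnt
      ... | reaches run b (fr′ , cnt′ , eq) with loop k fr′ cnt′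
      ...   | reaches run′ b′ (value , fr″) =
        reaches (while-true cnt run run′)
          (≤-trans (+-mono-≤ (+-monoʳ-≤ 2 b) b′) (≤-reflexive (sym (+-assoc (13 + (time N f + 2 + 2)) (k * _) 2))))
          (trans value eq , fr″)

    correct  : ∀ {Γ} (t : Term Γ) → Correct t
    corrects : ∀ {Γ k} (as : Vec (Term Γ) k) {ρ h σ} → h + needs as ≤ M → 1 < h → VecAll (_< h) ρ → σ ‼ 1 ≡ unary N →
      Reaches (compiles as ρ h) σ (times N as)
        (λ σ′ → read-all σ′ (registersFrom h k) ≡ evals N as (read-all σ ρ) × Frame h σ σ′)

    correct (var i) {ρ} {h} {σ} fit 1<h ρ<h ticks =
      by-assign (trans (‼-write σ h) (sym (lookup-map i (σ ‼_) ρ)) , frame-write ≤-refl (fits fit) frame-refl)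
    correct nil {h = h} {σ} fit 1<h ρ<h ticks =
      by-assign (‼-write σ h , frame-write ≤-refl (fits fit) frame-refl)
    correct clock {h = h} {σ} fit 1<h ρ<h ticks =
      by-assign (trans (‼-write σ h) ticks , frame-write ≤-refl (fits fit) frame-refl)
    correct (cons a b) {ρ} {h} {σ} fit 1<h ρ<h ticks =
      by-seq (correct a (fits-left h fit) 1<h ρ<h ticks) λ { {σ₁} (value , frame) →
      by-seq (correct b (fits-shift h 1 (fits-right h (need a) fit)) (m<n⇒m<1+n 1<h) (bounded-up (n≤1+n h) ρ<h)
                (trans (preserves frame 1<h) ticks)) λ { {σ₂} (value′ , frame′) →
      by-assign
        ( trans (‼-write σ₂ h) (cong₂ _∙_ (trans (preserves frame′ ≤-refl) value)
            (trans value′ (cong (eval N b) (read-all-frame ρ<h frame))))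
        , frame-write ≤-refl (fits fit) (frame-trans (n≤1+n h) frame frame′)) } }
    correct (hd a) {h = h} fit 1<h ρ<h ticks =
      by-seq (correct a fit 1<h ρ<h ticks) λ { {σ₁} (value , frame) →
      by-assign (trans (‼-write σ₁ h) (cong head value) , frame-write ≤-refl (fits fit) frame) }
    correct (tl a) {h = h} fit 1<h ρ<h ticks =
      by-seq (correct a fit 1<h ρ<h ticks) λ { {σ₁} (value , frame) →
      by-assign (trans (‼-write σ₁ h) (cong tail value) , frame-write ≤-refl (fits fit) frame) }
    correct (ite c a b) {ρ} {h} {σ} fit 1<h ρ<h ticks =
      by-seq (correct c (fits-left h fit) 1<h ρ<h ticks) λ { {σ₁} (value , frame) →
      by-cond (eval N c (read-all σ ρ)) value
        (λ v≢nil → weaken ≤-refl (λ { (value′ , frame′) →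
            trans value′ (trans (cong (eval N a) (read-all-frame ρ<h frame)) (sym (branch-true v≢nil)))
          , frame-trans ≤-refl frame frame′ })
          (correct a (fits-left h (fits-right h (need c) fit)) 1<h ρ<h (trans (preserves frame 1<h) ticks)))
        (λ v≡nil → weaken ≤-refl (λ { (value′ , frame′) →
            trans value′ (trans (cong (eval N b) (read-all-frame ρ<h frame)) (sym (cong (λ v → branch v _ _) v≡nil)))
          , frame-trans ≤-refl frame frame′ })
          (correct b (fits-right h (need a) (fits-right h (need c) fit)) 1<h ρ<h
            (trans (preserves frame 1<h) ticks))) }
    correct (app {k} f as) {ρ} {h} {σ} fit 1<h ρ<h ticks =
      by-seq (corrects as (fits-left h fit) 1<h ρ<h ticks) λ { {σ₁} (values , frame) →
      by-seq (correct f (fits-shift h k (fits-right h (needs as) fit)) (≤-trans 1<h (m≤n+m h k))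
                (registersFrom-bounded h k) (trans (preserves frame 1<h) ticks)) λ { {σ₂} (value , frame′) →
      by-assign
        ( trans (‼-write σ₂ h) (trans value (cong (eval N f) values))
        , frame-write ≤-refl (fits fit) (frame-trans (m≤n+m h k) frame frame′)) } }
    correct (fold l z f) {ρ} {h} {σ} fit 1<h ρ<h ticks =
      by-seq (correct l (fits-left h fit) 1<h ρ<h ticks) λ { {σ₁} (value , frame) →
      by-seq (correct z (fits-shift h 1 (fits-left h {b = 4 + need f} (fits-right h (need l) fit)))
                (m<n⇒m<1+n 1<h) (bounded-up (n≤1+n h) ρ<h)
                (trans (preserves frame 1<h) ticks)) λ { {σ₂} (value′ , frame′) →
      let fr₂ : Frame h σ σ₂
          fr₂ = frame-trans (n≤1+n h) frame frame′
          fitf = fits-shift h 4 (fits-right h (1 + need z) (fits-right h (need l) fit))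
          in2 = ≤-trans (m≤n+m (2 + h) 2) (fits fitf)
          σ₃ = σ₂ [ reg (2 + h) ]≔ unary N
          fr₃ : Frame h σ σ₃
          fr₃ = frame-write (m≤n+m h 2) in2 fr₂
      in
      by-seq (by-write (unary N) (trans (preserves fr₂ 1<h) ticks)) λ { refl →
      by-seq (Loop.loop f (correct f) fitf 1<h ρ<h (trans (preserves fr₃ 1<h) ticks) N frame-refl
                (‼-write σ₂ (2 + h))) λ { {σ₄} (value″ , frame″) →
      by-assign
        ( trans (‼-write σ₄ h) (trans value″ (trans
            (cong (λ ρ′ → foldTree N (λ x a → eval N f (x ∷ a ∷ ρ′)) (σ₃ ‼ h) (σ₃ ‼ (1 + h)))
              (read-all-frame ρ<h fr₃))
            (cong₂ (foldTree N _)
              (trans (‼-frame σ₂ in2 (m≤n+m _ 1)) (trans (preserves frame′ ≤-refl) value))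
              (trans (‼-frame σ₂ in2 ≤-refl) (trans value′ (cong (eval N z) (read-all-frame ρ<h frame)))))))
        , frame-write ≤-refl (fits fit) (frame-trans ≤-refl fr₃ frame″)) } } } }

    corrects [] fit 1<h ρ<h ticks = by-assign (refl , frame-write ≤-refl (fits fit) frame-refl)
    corrects (a ∷ as) {ρ} {h} {σ} fit 1<h ρ<h ticks =
      by-seq (correct a (fits-left h fit) 1<h ρ<h ticks) λ { {σ₁} (value , frame) →
      weaken ≤-refl (λ { (values , frame′) →
          cong₂ _∷_ (trans (preserves frame′ ≤-refl) value)
            (trans values (cong (evals N as) (read-all-frame ρ<h frame)))
        , frame-trans (n≤1+n h) frame frame′ })
        (corrects as (fits-shift h 1 (fits-right h (need a) fit)) (m<n⇒m<1+n 1<h)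
          (bounded-up (n≤1+n h) ρ<h) (trans (preserves frame 1<h) ticks)) }

-- Polynomial time

-- A single monomial serves as bound: for `1 ≤ N` a larger exponent only enlarges it, so two bounds
-- can be brought to a common degree. Sizes of trees are positive.
Polynomial : (ℕ → ℕ) → Set
Polynomial f = ∃[ a ] ∃[ d ] (∀ N → 1 ≤ N → f N ≤ a * N ^ d)

const-polynomial : ∀ c → Polynomial (λ _ → c)
const-polynomial c = c , 0 , λ N _ → ≤-reflexive (sym (*-identityʳ c))

id-polynomial : Polynomial (λ N → N)
id-polynomial = 1 , 1 , λ N _ → ≤-reflexive (sym (trans (*-identityˡ (N ^ 1)) (*-identityʳ N)))

*-polynomial : ∀ {f g} → Polynomial f → Polynomial g → Polynomial (λ N → f N * g N)
*-polynomial {f} {g} (a , d , p) (b , e , q) = a * b , d + e , λ N 1≤N → begin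
  f N * g N                   ≤⟨ *-mono-≤ (p N 1≤N) (q N 1≤N) ⟩
  (a * N ^ d) * (b * N ^ e)   ≡⟨ [m*n]*[o*p]≡[m*o]*[n*p] a (N ^ d) b (N ^ e) ⟩
  (a * b) * (N ^ d * N ^ e)   ≡⟨ cong (a * b *_) (^-distribˡ-+-* N d e) ⟨
  (a * b) * N ^ (d + e)       ∎
  where open ≤-Reasoning

+-polynomial : ∀ {f g} → Polynomial f → Polynomial g → Polynomial (λ N → f N + g N)
+-polynomial {f} {g} (a , d , p) (b , e , q) = a + b , d + e , λ N 1≤N →
  let instance _ = >-nonZero 1≤N in begin
  f N + g N                             ≤⟨ +-mono-≤ (p N 1≤N) (q N 1≤N) ⟩
  a * N ^ d + b * N ^ e                 ≤⟨ +-mono-≤ (*-monoʳ-≤ a (^-monoʳ-≤ N (m≤m+n d e)))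
                                                    (*-monoʳ-≤ b (^-monoʳ-≤ N (m≤n+m e d))) ⟩
  a * N ^ (d + e) + b * N ^ (d + e)     ≡⟨ *-distribʳ-+ (N ^ (d + e)) a b ⟨
  (a + b) * N ^ (d + e)                 ∎
  where open ≤-Reasoning

time-polynomial  : ∀ {Γ} (t : Term Γ) → Polynomial (λ N → time N t)
times-polynomial : ∀ {Γ k} (as : Vec (Term Γ) k) → Polynomial (λ N → times N as)

time-polynomial (var _)      = const-polynomial 2
time-polynomial nil          = const-polynomial 2
time-polynomial clock        = const-polynomial 2
time-polynomial (cons a b)   = +-polynomial (time-polynomial a)
                                 (+-polynomial (time-polynomial b) (const-polynomial 4))
time-polynomial (hd a)       = +-polynomial (time-polynomial a) (const-polynomial 3)
time-polynomial (tl a)       = +-polynomial (time-polynomial a) (const-polynomial 3)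
time-polynomial (ite c a b)  = +-polynomial (time-polynomial c) (+-polynomial (const-polynomial 2)
                                 (+-polynomial (time-polynomial a) (time-polynomial b)))
time-polynomial (app f as)   = +-polynomial (times-polynomial as)
                                 (+-polynomial (time-polynomial f) (const-polynomial 2))
time-polynomial (fold l z f) =
  +-polynomial (time-polynomial l) (+-polynomial (time-polynomial z) (+-polynomial (const-polynomial 2)
    (+-polynomial (+-polynomial (*-polynomial id-polynomial iteration) (const-polynomial 2)) (const-polynomial 2))))
  where
  iteration = +-polynomial (const-polynomial 13)
                (+-polynomial (+-polynomial (time-polynomial f) (const-polynomial 2)) (const-polynomial 2))

times-polynomial []       = const-polynomial 2
times-polynomial (a ∷ as) = +-polynomial (time-polynomial a) (times-polynomial as)

1≤size : ∀ t → 1 ≤ size t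
1≤size nil     = ≤-refl
1≤size (_ ∙ _) = s≤s z≤n

-- Computing the clock

module _ {M : ℕ} where

  -- Register 2 holds a stack of trees still to be counted; each pass removes
  -- one node of one of them and advances the clock in register 1.
  flattenStep flatten : Cmd (3 + M)
  flattenStep =
    suc zero ≔ cons nil (var (suc zero)) ⨾
    cond (hd stack)
      (suc (suc zero) ≔ cons (hd (hd stack)) (cons (tl (hd stack)) (tl stack)))
      (suc (suc zero) ≔ tl stack)
    where stack = var (suc (suc zero))
  flatten = while (var (suc (suc zero))) flattenStep

  -- A pass costs 12 at a leaf and 20 at an inner node; charging 20 for both makes the total
  -- proportional to the size.
  flatten-leaf : ∀ {x k s rest T Q} → Reaches flatten (x ∷ unary (suc k) ∷ s ∷ rest) T Q →
                 Reaches flatten (x ∷ unary k ∷ (nil ∙ s) ∷ rest) (20 + T) Q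
  flatten-leaf {T = T} (reaches run b q) =
    reaches (while-true refl (seq assign (if-false refl assign)) run) (+-mono-≤ (m≤m+n 12 8) b) q

  flatten-node : ∀ {x k t u s rest T Q} → Reaches flatten (x ∷ unary (suc k) ∷ (t ∙ u ∙ s) ∷ rest) T Q →
                 Reaches flatten (x ∷ unary k ∷ ((t ∙ u) ∙ s) ∷ rest) (20 + T) Q
  flatten-node (reaches run b q) =
    reaches (while-true refl (seq assign (if-true refl assign)) run) (+-monoʳ-≤ 20 b) q

  -- Stated in continuation style, because the loop does not stop between the two subtrees of a
  -- node: the run after `t` has been counted is taken as given, and the run on `t` is put in front
  -- of it.
  flatten-correct : ∀ t {x k s rest T Q} →
    Reaches flatten (x ∷ unary (size t + k) ∷ s ∷ rest) T Q →
    Reaches flatten (x ∷ unary k ∷ (t ∙ s) ∷ rest) (size t * 20 + T) Q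
  flatten-correct nil r = flatten-leaf r
  flatten-correct (t ∙ u) {x} {k} {s} {rest} {T} {Q} r =
    weaken (≤-reflexive spent-eq) (λ q → q)
      (flatten-node (flatten-correct t (flatten-correct u
        (subst (λ c → Reaches flatten (x ∷ unary c ∷ s ∷ rest) T Q) count-eq r))))
    where
    open ≡-Reasoning
    count-eq : size (t ∙ u) + k ≡ size u + (size t + suc k)
    count-eq = begin
      suc (size t + size u + k)   ≡⟨ +-suc (size t + size u) k ⟨
      size t + size u + suc k     ≡⟨ cong (_+ suc k) (+-comm (size t) (size u)) ⟩
      size u + size t + suc k     ≡⟨ +-assoc (size u) (size t) (suc k) ⟩
      size u + (size t + suc k)   ∎
    spent-eq : 20 + (size t * 20 + (size u * 20 + T)) ≡ size (t ∙ u) * 20 + T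
    spent-eq = cong (20 +_) (begin
      size t * 20 + (size u * 20 + T)  ≡⟨ +-assoc (size t * 20) (size u * 20) T ⟨
      size t * 20 + size u * 20 + T    ≡⟨ cong (_+ T) (*-distribʳ-+ 20 (size t) (size u)) ⟨
      (size t + size u) * 20 + T       ∎)

-- From terms to polynomial-time programs

program : Term 1 → Program
program t = record
  -- The clock, register 2 (the stack of `flatten`, later the result of `t`) and the scratch
  -- registers of `t`.
  { aux  = 2 + need t
  ; body = suc (suc zero) ≔ cons (var zero) nil ⨾ flatten ⨾ compile t (0 ∷ []) 2 ⨾ zero ≔ var (suc (suc zero))
  }
  where open Compiler

programTime : Term 1 → ℕ → ℕ
programTime t N = 4 + ((N * 20 + 2) + (time N t + 2))

program-correct : ∀ t x →
  Reaches (Program.body (program t)) (x ∷ Vec.replicate (2 + need t) nil) (programTime t (size x))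
    (λ σ → Vec.head σ ≡ eval (size x) t (x ∷ []))
program-correct t x = by-seq loaded λ { refl → by-seq clocked λ { refl → by-seq computed output } }
  where
  open Compiler
  rest = Vec.replicate (need t) nil
  clocked : Reaches (flatten {need t}) (x ∷ nil ∷ (x ∙ nil) ∷ rest) (size x * 20 + 2)
              (_≡ x ∷ unary (size x + 0) ∷ nil ∷ rest)
  clocked = flatten-correct x (reaches (while-false refl) ≤-refl refl)
  computed : Reaches (compile t (0 ∷ []) 2) (x ∷ unary (size x + 0) ∷ nil ∷ rest) (time (size x) t)
              (Result 2 (eval (size x) t (x ∷ [])) (x ∷ unary (size x + 0) ∷ nil ∷ rest))
  computed = correct (size x) t ≤-refl ≤-refl (s≤s z≤n ∷ []) (cong unary (+-identityʳ (size x)))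
  output : ∀ {σ} → Result 2 (eval (size x) t (x ∷ [])) (x ∷ unary (size x + 0) ∷ nil ∷ rest) σ →
           Reaches (zero ≔ var (suc (suc zero))) σ 2 (λ σ′ → Vec.head σ′ ≡ eval (size x) t (x ∷ []))
  output {v ∷ _} (value , _) = by-assign value
  loaded : Reaches (suc (suc zero) ≔ cons (var zero) nil) (x ∷ nil ∷ nil ∷ rest) 4 (_≡ x ∷ nil ∷ (x ∙ nil) ∷ rest)
  loaded = by-assign refl

programTime-polynomial : ∀ t → Polynomial (programTime t)
programTime-polynomial t =
  +-polynomial (const-polynomial 4)
    (+-polynomial (+-polynomial (*-polynomial id-polynomial (const-polynomial 20)) (const-polynomial 2))
      (+-polynomial (time-polynomial t) (const-polynomial 2)))

-- From here on only evaluation matters: a term that evaluates to a correct output, with the clock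
-- set to the size of the input, is already a polynomial-time algorithm.
polynomial-time-solvable : ∀ {A : Set} {encode : A → Tree} {D : A → Set} {R : A → Tree → Set} (t : Term 1) →
  (∀ i → D i → R i (eval (size (encode i)) t (encode i ∷ []))) → PolyTimeSolvable encode D R
polynomial-time-solvable {encode = encode} {D} {R} t right = within-bound (programTime-polynomial t)
  where
  within-bound : Polynomial (programTime t) → PolyTimeSolvable encode D R
  within-bound (a , d , p) = program t , a , d , λ i i∈D → _ , right i i∈D , yields (encode i)
    where
    finish : ∀ x → Reaches (Program.body (program t)) (x ∷ Vec.replicate (2 + need t) nil) (programTime t (size x))
               (λ σ → Vec.head σ ≡ eval (size x) t (x ∷ [])) →
             program t on x yields eval (size x) t (x ∷ []) within (a * size x ^ d + a)
    finish x (reaches run b q) = _ , _ , run , q , ≤-trans b (≤-trans (p (size x) (1≤size x)) (m≤m+n _ a))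
    yields : ∀ x → program t on x yields eval (size x) t (x ∷ []) within (a * size x ^ d + a)
    yields x = finish x (program-correct t x)

trueᵗ : ∀ {Γ} → Term Γ
trueᵗ = cons nil nil

branch-if : ∀ {A B : Set} (f : A → B) b {x y} → branch (encBool b) (f x) (f y) ≡ f (if b then x else y)
branch-if f false = refl
branch-if f true  = refl

branch-∧ : ∀ b c → branch (encBool b) (encBool c) nil ≡ encBool (b ∧ c)
branch-∧ false c = refl
branch-∧ true  c = refl

-- Lists

reverseᵗ : Term 1
reverseᵗ = fold (var 0F) nil (cons (var 0F) (var 1F))

-- `fold` consumes its list from the left. Reversing first gives a right fold, which follows the
-- recursion of `root`, `contract` and `any`, so that evaluation can be proved by induction on the
-- list.
foldrᵗ : ∀ {Γ} → Term Γ → Term Γ → Term (2 + Γ) → Term Γ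
foldrᵗ l z f = fold (app reverseᵗ (l ∷ [])) z f

foldTree-encList : ∀ {k g} xs {a} → length xs ≤ k → foldTree k g (encList xs) a ≡ List.foldl (flip g) a xs
foldTree-encList {zero}  []       _       = refl
foldTree-encList {suc k} []       _       = refl
foldTree-encList {suc k} (x ∷ xs) (s≤s p) = foldTree-encList xs p

foldl-∙ : ∀ xs ys → List.foldl (λ a x → x ∙ a) (encList ys) xs ≡ encList (xs ʳ++ ys)
foldl-∙ []       ys = refl
foldl-∙ (x ∷ xs) ys = foldl-∙ xs (x ∷ ys)

module Lists (N : ℕ) where

  eval-reverse : ∀ xs → length xs ≤ N → eval N reverseᵗ (encList xs ∷ []) ≡ encList (reverse xs)
  eval-reverse xs p = trans (foldTree-encList xs p) (foldl-∙ xs [])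

  eval-foldr : ∀ {Γ} (l z : Term Γ) f ρ xs → eval N l ρ ≡ encList xs → length xs ≤ N →
               eval N (foldrᵗ l z f) ρ ≡ List.foldr (λ x a → eval N f (x ∷ a ∷ ρ)) (eval N z ρ) xs
  eval-foldr l z f ρ xs eq p = begin
    foldTree N g (eval N reverseᵗ (eval N l ρ ∷ [])) a
      ≡⟨ cong (λ t → foldTree N g (eval N reverseᵗ (t ∷ [])) a) eq ⟩
    foldTree N g (eval N reverseᵗ (encList xs ∷ [])) a
      ≡⟨ cong (λ t → foldTree N g t a) (eval-reverse xs p) ⟩
    foldTree N g (encList (reverse xs)) a
      ≡⟨ foldTree-encList (reverse xs) (≤-trans (≤-reflexive (length-reverse xs)) p) ⟩
    List.foldl (flip g) a (reverse xs)
      ≡⟨ reverse-foldl (flip g) a xs ⟩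
    List.foldr g a xs
      ∎
    where
    open ≡-Reasoning
    g : Tree → Tree → Tree
    g x a = eval N f (x ∷ a ∷ ρ)
    a = eval N z ρ

-- Comparison of numbers

-- The accumulator pairs the verdict on the digits read so far, least
-- significant first, with the remaining digits of the second number.
leqStep : Term 4
leqStep = ite (tl (var 1F))
  (cons (ite (var 0F) (ite (hd (tl (var 1F))) (hd (var 1F)) trueᵗ) (ite (hd (tl (var 1F))) nil (hd (var 1F))))
        (tl (tl (var 1F))))
  nil

leqEnd : Term 1
leqEnd = ite (tl (var 0F)) trueᵗ (hd (var 0F))

leqᵗ sameᵗ : Term 2
leqᵗ  = app leqEnd (fold (var 0F) (cons trueᵗ (var 1F)) leqStep ∷ [])
sameᵗ = ite leqᵗ (app leqᵗ (var 1F ∷ var 0F ∷ [])) nil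

compareᵇ : Bool → ℕᵇ → ℕᵇ → Bool
compareᵇ f ℕᵇ.zero  ℕᵇ.zero  = f
compareᵇ f ℕᵇ.zero  2[1+ y ] = true
compareᵇ f ℕᵇ.zero  1+[2 y ] = true
compareᵇ f 2[1+ x ] ℕᵇ.zero  = false
compareᵇ f 2[1+ x ] 2[1+ y ] = compareᵇ f x y
compareᵇ f 2[1+ x ] 1+[2 y ] = compareᵇ false x y
compareᵇ f 1+[2 x ] ℕᵇ.zero  = false
compareᵇ f 1+[2 x ] 2[1+ y ] = compareᵇ true x y
compareᵇ f 1+[2 x ] 1+[2 y ] = compareᵇ f x y

-- The relation demanded of the unread digits. They may tie only if the digits read so far already
-- favour `≤`; otherwise they must be strictly smaller, since a higher digit outweighs all lower
-- ones.
Below : Bool → ℕᵇ → ℕᵇ → Set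
Below true  x y = x ℕᵇ.≤ y
Below false x y = x ℕᵇ.< y

Reflects-⇔ : ∀ {P Q : Set} {b} → (P → Q) → (Q → P) → Reflects P b → Reflects Q b
Reflects-⇔ f g r = proof (map′ f g (_ because r))

compareᵇ-reflects : ∀ f x y → Reflects (Below f x y) (compareᵇ f x y)
compareᵇ-reflects true  ℕᵇ.zero  ℕᵇ.zero  = ofʸ (inj₂ refl)
compareᵇ-reflects false ℕᵇ.zero  ℕᵇ.zero  = ofⁿ λ ()
compareᵇ-reflects true  ℕᵇ.zero  2[1+ y ] = ofʸ (inj₁ ℕᵇ.0<even)
compareᵇ-reflects false ℕᵇ.zero  2[1+ y ] = ofʸ ℕᵇ.0<even
compareᵇ-reflects true  ℕᵇ.zero  1+[2 y ] = ofʸ (inj₁ ℕᵇ.0<odd)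
compareᵇ-reflects false ℕᵇ.zero  1+[2 y ] = ofʸ ℕᵇ.0<odd
compareᵇ-reflects true  2[1+ x ] ℕᵇ.zero  = ofⁿ λ { (inj₁ ()) ; (inj₂ ()) }
compareᵇ-reflects false 2[1+ x ] ℕᵇ.zero  = ofⁿ λ ()
compareᵇ-reflects true  1+[2 x ] ℕᵇ.zero  = ofⁿ λ { (inj₁ ()) ; (inj₂ ()) }
compareᵇ-reflects false 1+[2 x ] ℕᵇ.zero  = ofⁿ λ ()
compareᵇ-reflects true  2[1+ x ] 2[1+ y ] = Reflects-⇔
  (λ { (inj₁ p) → inj₁ (ℕᵇ.even<even p) ; (inj₂ refl) → inj₂ refl })
  (λ { (inj₁ (ℕᵇ.even<even p)) → inj₁ p ; (inj₂ refl) → inj₂ refl }) (compareᵇ-reflects true x y)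
compareᵇ-reflects false 2[1+ x ] 2[1+ y ] =
  Reflects-⇔ ℕᵇ.even<even (λ { (ℕᵇ.even<even p) → p }) (compareᵇ-reflects false x y)
compareᵇ-reflects true  2[1+ x ] 1+[2 y ] =
  Reflects-⇔ (inj₁ ∘ ℕᵇ.even<odd) (λ { (inj₁ (ℕᵇ.even<odd p)) → p }) (compareᵇ-reflects false x y)
compareᵇ-reflects false 2[1+ x ] 1+[2 y ] =
  Reflects-⇔ ℕᵇ.even<odd (λ { (ℕᵇ.even<odd p) → p }) (compareᵇ-reflects false x y)
compareᵇ-reflects true  1+[2 x ] 2[1+ y ] =
  Reflects-⇔ (inj₁ ∘ ℕᵇ.odd<even) (λ { (inj₁ (ℕᵇ.odd<even p)) → p }) (compareᵇ-reflects true x y)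
compareᵇ-reflects false 1+[2 x ] 2[1+ y ] =
  Reflects-⇔ ℕᵇ.odd<even (λ { (ℕᵇ.odd<even p) → p }) (compareᵇ-reflects true x y)
compareᵇ-reflects true  1+[2 x ] 1+[2 y ] = Reflects-⇔
  (λ { (inj₁ p) → inj₁ (ℕᵇ.odd<odd p) ; (inj₂ refl) → inj₂ refl })
  (λ { (inj₁ (ℕᵇ.odd<odd p)) → inj₁ p ; (inj₂ refl) → inj₂ refl }) (compareᵇ-reflects true x y)
compareᵇ-reflects false 1+[2 x ] 1+[2 y ] =
  Reflects-⇔ ℕᵇ.odd<odd (λ { (ℕᵇ.odd<odd p) → p }) (compareᵇ-reflects false x y)

compareᵇ-fromℕ : ∀ a b → compareᵇ true (ℕᵇ.fromℕ a) (ℕᵇ.fromℕ b) ≡ does (a ≤? b)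
compareᵇ-fromℕ a b = det
  (Reflects-⇔ ℕᵇ.fromℕ-cancel-≤ ℕᵇ.fromℕ-mono-≤ (compareᵇ-reflects true (ℕᵇ.fromℕ a) (ℕᵇ.fromℕ b)))
  (proof (a ≤? b))

module Comparison (N : ℕ) where

  private
    step : Vec Tree 2 → Tree → Tree → Tree
    step ρ d acc = eval N leqStep (d ∷ acc ∷ ρ)

    end : Tree → Tree
    end acc = eval N leqEnd (acc ∷ [])

  -- The state becomes `nil` when the second number runs out of digits before the first. This state
  -- is absorbing, and `leqEnd` reads it as false.
  leqStep-nil : ∀ ρ k t → foldTree k (step ρ) t nil ≡ nil
  leqStep-nil ρ zero    t       = refl
  leqStep-nil ρ (suc k) nil     = refl
  leqStep-nil ρ (suc k) (x ∙ t) = leqStep-nil ρ k t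

  leq-loop : ∀ ρ k f x y → ℕᵇ.size x ≤ k →
             end (foldTree k (step ρ) (encBin x) (encBool f ∙ encBin y)) ≡ encBool (compareᵇ f x y)
  leq-loop ρ k       f ℕᵇ.zero  ℕᵇ.zero  _ = cong end (foldTree-nil k)
  leq-loop ρ k       f ℕᵇ.zero  2[1+ y ] _ = cong end (foldTree-nil k)
  leq-loop ρ k       f ℕᵇ.zero  1+[2 y ] _ = cong end (foldTree-nil k)
  leq-loop ρ (suc k) f 2[1+ x ] ℕᵇ.zero  _ = cong end (leqStep-nil ρ k (encBin x))
  leq-loop ρ (suc k) f 1+[2 x ] ℕᵇ.zero  _ = cong end (leqStep-nil ρ k (encBin x))
  leq-loop ρ (suc k) f 2[1+ x ] 2[1+ y ] (s≤s p) = leq-loop ρ k f x y p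
  leq-loop ρ (suc k) f 2[1+ x ] 1+[2 y ] (s≤s p) = leq-loop ρ k false x y p
  leq-loop ρ (suc k) f 1+[2 x ] 2[1+ y ] (s≤s p) = leq-loop ρ k true x y p
  leq-loop ρ (suc k) f 1+[2 x ] 1+[2 y ] (s≤s p) = leq-loop ρ k f x y p

  -- The fold runs over the digits of the first number, so it is this number whose length must stay
  -- within the clock.
  eval-leq : ∀ a b → ℕᵇ.size (ℕᵇ.fromℕ a) ≤ N → eval N leqᵗ (encℕ a ∷ encℕ b ∷ []) ≡ encBool (does (a ≤? b))
  eval-leq a b p = trans
    (leq-loop (encℕ a ∷ encℕ b ∷ []) N true (ℕᵇ.fromℕ a) (ℕᵇ.fromℕ b) p)
    (cong encBool (compareᵇ-fromℕ a b))

  eval-same : ∀ a b → ℕᵇ.size (ℕᵇ.fromℕ a) ≤ N → ℕᵇ.size (ℕᵇ.fromℕ b) ≤ N →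
              eval N sameᵗ (encℕ a ∷ encℕ b ∷ []) ≡ encBool (does (a ≟ b))
  eval-same a b p q = begin
    branch (eval N leqᵗ (encℕ a ∷ encℕ b ∷ [])) (eval N leqᵗ (encℕ b ∷ encℕ a ∷ [])) nil
      ≡⟨ cong₂ (λ s t → branch s t nil) (eval-leq a b p) (eval-leq b a q) ⟩
    branch (encBool (does (a ≤? b))) (encBool (does (b ≤? a))) nil
      ≡⟨ branch-∧ (does (a ≤? b)) (does (b ≤? a)) ⟩
    encBool (does (a ≤? b ×-dec b ≤? a))
      ≡⟨ cong encBool (does-⇔ (mk⇔ (λ { (u , v) → ≤-antisym u v }) (λ { refl → ≤-refl , ≤-refl }))
           (a ≤? b ×-dec b ≤? a) (a ≟ b)) ⟩
    encBool (does (a ≟ b)) ∎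
    where
    open ≡-Reasoning

-- Addition of numbers

-- In bijective binary the least number with n digits is 1...1, which equals 2^n - 1.
2^size≤ : ∀ x → 2 ^ ℕᵇ.size x ≤ suc (ℕᵇ.toℕ x)
2^size≤ ℕᵇ.zero  = ≤-refl
2^size≤ 2[1+ x ] = ≤-trans (*-monoʳ-≤ 2 (2^size≤ x)) (n≤1+n _)
2^size≤ 1+[2 x ] = ≤-trans (*-monoʳ-≤ 2 (2^size≤ x)) (≤-reflexive (cong suc (+-suc (ℕᵇ.toℕ x) _)))

size-fromℕ : ∀ {a k} → a < 2 ^ k → ℕᵇ.size (ℕᵇ.fromℕ a) ≤ k
size-fromℕ {a} {k} a<2^k = ≮⇒≥ λ k<size → <⇒≱ (^-monoʳ-< 2 ≤-refl k<size)
  (≤-trans (2^size≤ (ℕᵇ.fromℕ a)) (≤-trans (s≤s (≤-reflexive (ℕᵇ.toℕ-fromℕ a))) a<2^k))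

-- Adds the lowest digit to a unary number. The head of a nonempty digit list is `true` for the
-- digit 1 and `false` for the digit 2; an exhausted number contributes nothing.
addDigit : Term 2
addDigit = ite (var 0F) (ite (hd (var 0F)) (cons nil (var 1F)) (cons nil (cons nil (var 1F)))) (var 1F)

-- The digits of encℕ are 1 and 2, so the carry is at most 2 and the lowest
-- digits and the carry add up to at most 6.  The state consists of the carry,
-- the unread digits of both summands and, in reverse, the digits of the sum.
emit : Term 4
emit =
  ite s0 (ite s1 (ite s2 (ite s3 (ite s4 (ite s5
    (next false 2) (next true 2)) (next false 1)) (next true 1)) (next false 0)) (next true 0))
    (cons nil (cons (var 1F) (cons (var 2F) (var 3F))))
  where
  s0 s1 s2 s3 s4 s5 : Term 4
  s0 = var 0F
  s1 = tl s0
  s2 = tl s1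
  s3 = tl s2
  s4 = tl s3
  s5 = tl s4
  carryᵗ : ℕ → Term 4
  carryᵗ zero    = nil
  carryᵗ (suc c) = cons nil (carryᵗ c)
  next : Bool → ℕ → Term 4
  next odd c = cons (carryᵗ c) (cons (var 1F) (cons (var 2F) (cons (if odd then trueᵗ else nil) (var 3F))))

addStep : Term 4
addStep = app emit
  (app addDigit (hd (tl (tl (var 1F))) ∷ app addDigit (hd (tl (var 1F)) ∷ hd (var 1F) ∷ []) ∷ []) ∷
   tl (hd (tl (var 1F))) ∷ tl (hd (tl (tl (var 1F)))) ∷ tl (tl (tl (var 1F))) ∷ [])

-- The fold runs over the clock rather than over a summand, because the summands may differ in
-- length and the carry may outlive both.
addᵗ : Term 2
addᵗ = app reverseᵗ (tl (tl (tl (fold clock (cons nil (cons (var 0F) (cons (var 1F) nil))) addStep))) ∷ [])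

lowDigit : ℕᵇ → ℕ
lowDigit ℕᵇ.zero  = 0
lowDigit 2[1+ x ] = 2
lowDigit 1+[2 x ] = 1

otherDigits : ℕᵇ → ℕᵇ
otherDigits ℕᵇ.zero  = ℕᵇ.zero
otherDigits 2[1+ x ] = x
otherDigits 1+[2 x ] = x

toℕ-split : ∀ x → ℕᵇ.toℕ x ≡ lowDigit x + 2 * ℕᵇ.toℕ (otherDigits x)
toℕ-split ℕᵇ.zero  = refl
toℕ-split 2[1+ x ] = *-distribˡ-+ 2 1 (ℕᵇ.toℕ x)
toℕ-split 1+[2 x ] = refl

lowDigit≤2 : ∀ x → lowDigit x ≤ 2
lowDigit≤2 ℕᵇ.zero  = z≤n
lowDigit≤2 2[1+ x ] = ≤-refl
lowDigit≤2 1+[2 x ] = s≤s z≤n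

bits : ℕᵇ → List Tree
bits ℕᵇ.zero  = []
bits 2[1+ x ] = encBool false ∷ bits x
bits 1+[2 x ] = encBool true ∷ bits x

encList-bits : ∀ x → encList (bits x) ≡ encBin x
encList-bits ℕᵇ.zero  = refl
encList-bits 2[1+ x ] = cong (nil ∙_) (encList-bits x)
encList-bits 1+[2 x ] = cong (_ ∙_) (encList-bits x)

length-bits : ∀ x → length (bits x) ≡ ℕᵇ.size x
length-bits ℕᵇ.zero  = refl
length-bits 2[1+ x ] = cong suc (length-bits x)
length-bits 1+[2 x ] = cong suc (length-bits x)

fromℕ-odd : ∀ s → ℕᵇ.fromℕ (1 + 2 * s) ≡ 1+[2 ℕᵇ.fromℕ s ]
fromℕ-odd s = ℕᵇ.toℕ-injective (trans (ℕᵇ.toℕ-fromℕ _) (cong (λ t → 1 + 2 * t) (sym (ℕᵇ.toℕ-fromℕ s))))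

fromℕ-even : ∀ s → ℕᵇ.fromℕ (2 + 2 * s) ≡ 2[1+ ℕᵇ.fromℕ s ]
fromℕ-even s = ℕᵇ.toℕ-injective (trans (ℕᵇ.toℕ-fromℕ _)
  (trans (sym (*-distribˡ-+ 2 1 s)) (cong (λ t → 2 * suc t) (sym (ℕᵇ.toℕ-fromℕ s)))))

module Addition (N : ℕ) where

  open Lists N

  private
    state : ℕ → ℕᵇ → ℕᵇ → List Tree → Tree
    state c x y o = unary c ∙ encBin x ∙ encBin y ∙ encList o

    step : Vec Tree 2 → Tree → Tree → Tree
    step ρ d acc = eval N addStep (d ∷ acc ∷ ρ)

    total : ℕ → ℕᵇ → ℕᵇ → ℕ
    total c x y = c + (ℕᵇ.toℕ x + ℕᵇ.toℕ y)

  eval-addDigit : ∀ x c → eval N addDigit (encBin x ∷ unary c ∷ []) ≡ unary (lowDigit x + c)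
  eval-addDigit ℕᵇ.zero  c = refl
  eval-addDigit 2[1+ x ] c = refl
  eval-addDigit 1+[2 x ] c = refl

  emitted : ℕ → ℕᵇ → ℕᵇ → List Tree → Tree
  emitted s x y o = eval N emit (unary s ∷ encBin x ∷ encBin y ∷ encList o ∷ [])

  tail-encBin : ∀ x → tail (encBin x) ≡ encBin (otherDigits x)
  tail-encBin ℕᵇ.zero  = refl
  tail-encBin 2[1+ x ] = refl
  tail-encBin 1+[2 x ] = refl

  step-emits : ∀ ρ d c x y o →
    step ρ d (state c x y o) ≡ emitted (lowDigit y + (lowDigit x + c)) (otherDigits x) (otherDigits y) o
  step-emits ρ d c x y o
    rewrite eval-addDigit x c | eval-addDigit y (lowDigit x + c) | tail-encBin x | tail-encBin y = refl

  -- A positive sum is 1 + 2c or 2 + 2c for exactly one c: the digit to write is 1 or 2, and c is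
  -- carried. This view checks the decision tree of `emit` once and leaves three cases for the loop.
  data Emission : ℕ → Set where
    none : Emission 0
    odd  : ∀ c → c ≤ 2 → (∀ x y o → emitted (1 + 2 * c) x y o ≡ state c x y (encBool true ∷ o)) →
           Emission (1 + 2 * c)
    even : ∀ c → c ≤ 2 → (∀ x y o → emitted (2 + 2 * c) x y o ≡ state c x y (encBool false ∷ o)) →
           Emission (2 + 2 * c)

  emission : ∀ {s} → s ≤ 6 → Emission s
  emission {0} _ = none
  emission {1} _ = odd 0 z≤n λ _ _ _ → refl
  emission {2} _ = even 0 z≤n λ _ _ _ → refl
  emission {3} _ = odd 1 (s≤s z≤n) λ _ _ _ → refl
  emission {4} _ = even 1 (s≤s z≤n) λ _ _ _ → refl
  emission {5} _ = odd 2 ≤-refl λ _ _ _ → refl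
  emission {6} _ = even 2 ≤-refl λ _ _ _ → refl
  emission {suc (suc (suc (suc (suc (suc (suc _))))))} (s≤s (s≤s (s≤s (s≤s (s≤s (s≤s ()))))))

  -- Digits of bijective binary are never 0, so a zero sum means that the carry and both summands
  -- are used up. The remaining ticks then leave the state alone.
  sum≡0 : ∀ c x y → lowDigit y + (lowDigit x + c) ≡ 0 → c ≡ 0 × x ≡ ℕᵇ.zero × y ≡ ℕᵇ.zero
  sum≡0 c ℕᵇ.zero ℕᵇ.zero c≡0 = c≡0 , refl , refl

  total-split : ∀ c x y →
    total c x y ≡ lowDigit y + (lowDigit x + c) + 2 * (ℕᵇ.toℕ (otherDigits x) + ℕᵇ.toℕ (otherDigits y))
  total-split c x y = trans (cong₂ (λ u v → c + (u + v)) (toℕ-split x) (toℕ-split y))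
    (solve 5 (λ c a b u v → c :+ ((a :+ con 2 :* u) :+ (b :+ con 2 :* v)) := b :+ (a :+ c) :+ con 2 :* (u :+ v)) refl
      c (lowDigit x) (lowDigit y) (ℕᵇ.toℕ (otherDigits x)) (ℕᵇ.toℕ (otherDigits y)))
    where open +-*-Solver

  double-carry : ∀ d c t → d + 2 * c + 2 * t ≡ d + 2 * (c + t)
  double-carry d c t = trans (+-assoc d (2 * c) (2 * t)) (cong (d +_) (sym (*-distribˡ-+ 2 c t)))

  sumDigits : Vec Tree 2 → ℕ → Tree → Tree
  sumDigits ρ k st = tail (tail (tail (foldTree k (step ρ) (unary k) st)))

  -- Writing a digit at least halves what remains to be written, so `k` ticks suffice for totals
  -- below 2^k. `o` holds the finished lower digits in reverse, hence `ʳ++`.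
  add-loop : ∀ ρ k c x y o → c ≤ 2 → total c x y < 2 ^ k →
    sumDigits ρ k (state c x y o) ≡ encList (bits (ℕᵇ.fromℕ (total c x y)) ʳ++ o)
  add-loop ρ zero c x y o c≤2 small = sym (cong (λ t → encList (bits (ℕᵇ.fromℕ t) ʳ++ o)) (n<1⇒n≡0 small))
  add-loop ρ (suc k) c x y o c≤2 small =
    trans (cong (sumDigits ρ k) (step-emits ρ nil c x y o))
      (continue (emission (+-mono-≤ (lowDigit≤2 y) (+-mono-≤ (lowDigit≤2 x) c≤2))) refl)
    where
    x′ = otherDigits x
    y′ = otherDigits y
    s  = lowDigit y + (lowDigit x + c)
    halved : ∀ d c′ → 0 < d → s ≡ d + 2 * c′ → total c x y ≡ d + 2 * total c′ x′ y′ × total c′ x′ y′ < 2 ^ k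
    halved d c′ 0<d s≡ = eq , *-cancelˡ-< 2 _ _ (<-trans (m<n+m _ 0<d) (subst (_< 2 ^ suc k) eq small))
      where
      eq : total c x y ≡ d + 2 * total c′ x′ y′
      eq = trans (total-split c x y) (trans (cong (_+ 2 * (ℕᵇ.toℕ x′ + ℕᵇ.toℕ y′)) s≡) (double-carry d c′ _))
    continue : ∀ {s′} → Emission s′ → s ≡ s′ →
      sumDigits ρ k (emitted s x′ y′ o) ≡ encList (bits (ℕᵇ.fromℕ (total c x y)) ʳ++ o)
    continue none s≡0 with sum≡0 c x y s≡0
    ... | refl , refl , refl = add-loop ρ k 0 ℕᵇ.zero ℕᵇ.zero o z≤n (m^n>0 2 k)
    continue (odd c′ c′≤2 emits) s≡ with halved 1 c′ (s≤s z≤n) s≡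
    ... | eq , small′ = begin
      sumDigits ρ k (emitted s x′ y′ o)
        ≡⟨ cong (λ s → sumDigits ρ k (emitted s x′ y′ o)) s≡ ⟩
      sumDigits ρ k (emitted (1 + 2 * c′) x′ y′ o)
        ≡⟨ cong (sumDigits ρ k) (emits x′ y′ o) ⟩
      sumDigits ρ k (state c′ x′ y′ (encBool true ∷ o))
        ≡⟨ add-loop ρ k c′ x′ y′ (encBool true ∷ o) c′≤2 small′ ⟩
      encList (bits 1+[2 ℕᵇ.fromℕ t ] ʳ++ o)
        ≡⟨ cong (λ b → encList (bits b ʳ++ o)) (trans (cong ℕᵇ.fromℕ eq) (fromℕ-odd t)) ⟨
      encList (bits (ℕᵇ.fromℕ (total c x y)) ʳ++ o)
        ∎
      where
      open ≡-Reasoning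
      t = total c′ x′ y′
    continue (even c′ c′≤2 emits) s≡ with halved 2 c′ (s≤s z≤n) s≡
    ... | eq , small′ = begin
      sumDigits ρ k (emitted s x′ y′ o)
        ≡⟨ cong (λ s → sumDigits ρ k (emitted s x′ y′ o)) s≡ ⟩
      sumDigits ρ k (emitted (2 + 2 * c′) x′ y′ o)
        ≡⟨ cong (sumDigits ρ k) (emits x′ y′ o) ⟩
      sumDigits ρ k (state c′ x′ y′ (encBool false ∷ o))
        ≡⟨ add-loop ρ k c′ x′ y′ (encBool false ∷ o) c′≤2 small′ ⟩
      encList (bits 2[1+ ℕᵇ.fromℕ t ] ʳ++ o)
        ≡⟨ cong (λ b → encList (bits b ʳ++ o)) (trans (cong ℕᵇ.fromℕ eq) (fromℕ-even t)) ⟨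
      encList (bits (ℕᵇ.fromℕ (total c x y)) ʳ++ o)
        ∎
      where
      open ≡-Reasoning
      t = total c′ x′ y′

  eval-add : ∀ a b → a + b < 2 ^ N → eval N addᵗ (encℕ a ∷ encℕ b ∷ []) ≡ encℕ (a + b)
  eval-add a b small = begin
    eval N reverseᵗ (digits ∷ [])                     ≡⟨ cong (λ t → eval N reverseᵗ (t ∷ [])) looped ⟩
    eval N reverseᵗ (encList (reverse result) ∷ [])   ≡⟨ eval-reverse (reverse result) short ⟩
    encList (reverse (reverse result))                ≡⟨ cong encList (reverse-involutive result) ⟩
    encList result                                    ≡⟨ encList-bits (ℕᵇ.fromℕ (a + b)) ⟩
    encℕ (a + b)                                      ∎
    where
    open ≡-Reasoning
    result = bits (ℕᵇ.fromℕ (a + b))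
    digits = sumDigits (encℕ a ∷ encℕ b ∷ []) N (state 0 (ℕᵇ.fromℕ a) (ℕᵇ.fromℕ b) [])
    total≡ : total 0 (ℕᵇ.fromℕ a) (ℕᵇ.fromℕ b) ≡ a + b
    total≡ = cong₂ _+_ (ℕᵇ.toℕ-fromℕ a) (ℕᵇ.toℕ-fromℕ b)
    looped : digits ≡ encList (reverse result)
    looped = trans
      (add-loop (encℕ a ∷ encℕ b ∷ []) N 0 (ℕᵇ.fromℕ a) (ℕᵇ.fromℕ b) [] z≤n
        (subst (_< 2 ^ N) (sym total≡) small))
      (cong (λ t → encList (reverse (bits (ℕᵇ.fromℕ t)))) total≡)
    short : length (reverse result) ≤ N
    short = ≤-trans (≤-reflexive (trans (length-reverse result) (length-bits (ℕᵇ.fromℕ (a + b)))))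
              (size-fromℕ {a + b} {N} small)

-- Edge separation in trees

module _ {A : Set} (θ : A → ℕ) where

  sum-remove : ∀ {x} ys (p : x ∈ ys) → sum (List.map θ ys) ≡ θ x + sum (List.map θ (ys Any.─ p))
  sum-remove (y ∷ ys) (here refl) = refl
  sum-remove {x} (y ∷ ys) (there p) = begin
    θ y + sum (List.map θ ys)                          ≡⟨ cong (θ y +_) (sum-remove ys p) ⟩
    θ y + (θ x + sum (List.map θ (ys Any.─ p)))        ≡⟨ +-assoc (θ y) (θ x) _ ⟨
    θ y + θ x + sum (List.map θ (ys Any.─ p))          ≡⟨ cong (_+ sum (List.map θ (ys Any.─ p)))
                                                            (+-comm (θ y) (θ x)) ⟩
    θ x + θ y + sum (List.map θ (ys Any.─ p))          ≡⟨ +-assoc (θ x) (θ y) _ ⟩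
    θ x + (θ y + sum (List.map θ (ys Any.─ p)))        ∎
    where
    open ≡-Reasoning

  ∈-remove : ∀ {x z : A} {ys} (p : x ∈ ys) → z ∈ ys → z ≢ x → z ∈ (ys Any.─ p)
  ∈-remove (here refl) (here refl) z≢x = ⊥-elim (z≢x refl)
  ∈-remove (here refl) (there q)   z≢x = q
  ∈-remove (there p)   (here refl) z≢x = here refl
  ∈-remove (there p)   (there q)   z≢x = there (∈-remove p q z≢x)

  -- Each element of `xs` is paid for by one occurrence in `ys`. As `xs` has no repetitions,
  -- deleting that occurrence still leaves the rest of `xs` covered.
  sum-⊆ : ∀ {xs ys} → Unique xs → (∀ {z} → z ∈ xs → z ∈ ys) → sum (List.map θ xs) ≤ sum (List.map θ ys)
  sum-⊆ {[]}     _        _     = z≤n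
  sum-⊆ {x ∷ xs} {ys} (x∉xs ∷ u) xs⊆ys = ≤-trans
    (+-monoʳ-≤ (θ x) (sum-⊆ u λ z∈xs → ∈-remove p (xs⊆ys (there z∈xs)) λ { refl → All.lookup x∉xs z∈xs refl }))
    (≤-reflexive (sym (sum-remove ys p)))
    where p = xs⊆ys (here refl)

pair-≡ : ∀ {n} {P Q : Pair n} → Pair.fst P ≡ Pair.fst Q → Pair.snd P ≡ Pair.snd Q → P ≡ Q
pair-≡ refl refl = refl

antiparallel : ∀ {n} (P Q : Pair n) → Pair.fst P ≡ Pair.snd Q → Pair.snd P ≡ Pair.fst Q → ⊥
antiparallel (pair a b a<b) (pair _ _ b<a) refl refl = ⊥-elim-irr (Fin.<-asym a<b b<a)

irreflexive : ∀ {n} (P : Pair n) → Pair.fst P ≢ Pair.snd P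
irreflexive (pair a _ a<a) refl = ⊥-elim-irr (Fin.<-irrefl refl a<a)

sum-tabulate-mono : ∀ {k} (f g : Fin k → ℕ) →
  (∀ i → f i ≤ g i) → Vec.sum (Vec.tabulate f) ≤ Vec.sum (Vec.tabulate g)
sum-tabulate-mono {zero}  f g f≤g = z≤n
sum-tabulate-mono {suc k} f g f≤g =
  +-mono-≤ (f≤g Fin.zero) (sum-tabulate-mono (f ∘ Fin.suc) (g ∘ Fin.suc) (f≤g ∘ Fin.suc))

n/n≡1 : ∀ d .{{_ : NonZero d}} → ℤ.+ d ℚ./ d ≡ 1ℚ
n/n≡1 d@(suc d-1) = ℚ.fromℚᵘ-cong {ℚᵘ.mkℚᵘ (ℤ.+ d) d-1} {ℚᵘ.1ℚᵘ} (ℚᵘ.*≡* (ℤ.*-comm (ℤ.+ d) (ℤ.+ 1)))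

-- Component labels by contraction

module Labelling (G : Graph) where

  open Graph G

  replace : V × V → V → V
  replace (v , u) w = if does (w Fin.≟ v) then u else w

  root : V → List (V × V) → V
  root = List.foldr replace

  -- Contracts the given edges other than e, the last edge first.  A pair
  -- (v , u) redirects the label v to u; the head of the list is applied last.
  contract : E → List E → List (V × V)
  contract e []       = []
  contract e (f ∷ fs) = if does (f Fin.≟ e) then S else (root snd S , root fst S) ∷ S
    where
    S = contract e fs
    open Pair (ends f)

  label : E → V → V
  label e x = root x (contract e (allFin m))

  length-contract : ∀ e fs → length (contract e fs) ≤ length fs
  length-contract e [] = z≤n
  length-contract e (f ∷ fs) with does (f Fin.≟ e)
  ... | true  = ≤-trans (length-contract e fs) (n≤1+n _)
  ... | false = s≤s (length-contract e fs)

  Joins-sym : ∀ {e u v} → Joins e u v → Joins e v u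
  Joins-sym (inj₁ (p , q)) = inj₂ (p , q)
  Joins-sym (inj₂ (p , q)) = inj₁ (p , q)

  Avoiding : E → V → V → Set
  Avoiding e = Star λ u v → ∃[ f ] f ≢ e × Joins f u v

  Avoiding-sym : ∀ {e u v} → Avoiding e u v → Avoiding e v u
  Avoiding-sym = Star.reverse λ (f , f≢e , j) → f , f≢e , Joins-sym j

  replace-self : ∀ v u → replace (v , u) v ≡ u
  replace-self v u with v Fin.≟ v
  ... | yes _   = refl
  ... | no  v≢v = ⊥-elim (v≢v refl)

  replace-miss-or-hit : ∀ v u w → replace (v , u) w ≡ w ⊎ (w ≡ v × replace (v , u) w ≡ u)
  replace-miss-or-hit v u w with w Fin.≟ v
  ... | yes w≡v = inj₂ (w≡v , refl)
  ... | no  _   = inj₁ refl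

  -- The redirection added for `f` gives the label of one end to the other, also if both labels
  -- agree already. Later redirections act on labels alone and so preserve equality.
  contracted : ∀ {e f} fs → f ∈ fs → f ≢ e →
               root (Pair.fst (ends f)) (contract e fs) ≡ root (Pair.snd (ends f)) (contract e fs)
  contracted {e} (f ∷ fs) (here refl) f≢e with f Fin.≟ e
  ... | yes f≡e = ⊥-elim (f≢e f≡e)
  ... | no  _   = merged (root (Pair.fst (ends f)) S) (root (Pair.snd (ends f)) S)
    where
    S = contract e fs
    merged : ∀ u v → replace (v , u) u ≡ replace (v , u) v
    merged u v with replace-miss-or-hit v u u
    ... | inj₁ eq       = trans eq (sym (replace-self v u))
    ... | inj₂ (_ , eq) = trans eq (sym (replace-self v u))
  contracted {e} (g ∷ fs) (there f∈fs) f≢e with does (g Fin.≟ e)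
  ... | true  = contracted fs f∈fs f≢e
  ... | false = cong (replace _) (contracted fs f∈fs f≢e)

  label-edge : ∀ {e f u v} → f ≢ e → Joins f u v → label e u ≡ label e v
  label-edge f≢e (inj₁ (refl , refl)) = contracted (allFin m) (∈-allFin _) f≢e
  label-edge f≢e (inj₂ (refl , refl)) = sym (contracted (allFin m) (∈-allFin _) f≢e)

  label-walk : ∀ {e u v} (w : Walk u v) → All (_≢ e) (edges w) → label e u ≡ label e v
  label-walk ε             []            = refl
  label-walk ((f , j) ◅ w) (f≢e ∷ avoid) = trans (label-edge f≢e j) (label-walk w avoid)

  -- When the redirection for `f` hits the label of x, that label is also the label of the second
  -- end of `f`. The walk goes from x to this common label, on to the second end, across `f`, and
  -- from the first end to its label.
  root-avoiding : ∀ e fs x → Avoiding e x (root x (contract e fs))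
  root-avoiding e []       x = ε
  root-avoiding e (f ∷ fs) x with f Fin.≟ e
  ... | yes _   = root-avoiding e fs x
  ... | no  f≢e with replace-miss-or-hit (root (Pair.snd (ends f)) S) (root (Pair.fst (ends f)) S) (root x S)
    where S = contract e fs
  ...   | inj₁ eq         = subst (Avoiding e x) (sym eq) (root-avoiding e fs x)
  ...   | inj₂ (hit , eq) = subst (Avoiding e x) (sym eq)
    (root-avoiding e fs x
      ◅◅ subst (λ y → Avoiding e y (Pair.snd (ends f))) (sym hit) (Avoiding-sym (root-avoiding e fs _))
      ◅◅ (f , f≢e , inj₂ (refl , refl)) ◅ root-avoiding e fs _)

  label-avoiding : ∀ {e u v} → label e u ≡ label e v → Avoiding e u v
  label-avoiding {e} {u} {v} eq =
    subst (Avoiding e u) eq (root-avoiding e (allFin m) u) ◅◅ Avoiding-sym (root-avoiding e (allFin m) v)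

  AvoidingPath : E → V → V → Set
  AvoidingPath e u v = Σ (Path u v) λ P → All (_≢ e) (edges (proj₁ P))

  path-from : ∀ {e u v t} (w : Walk v t) → Unique (vertices w) → All (_≢ e) (edges w) →
              u ∈ vertices w → AvoidingPath e u t
  path-from ε       unique avoid (here refl) = (ε , unique) , avoid
  path-from (a ◅ w) unique avoid (here refl) = (a ◅ w , unique) , avoid
  path-from (a ◅ w) (_ ∷ unique) (_ ∷ avoid) (there u∈w) = path-from w unique avoid u∈w

  -- Loops are cut out from the far end: if the new start already lies on the path, everything
  -- before that occurrence is dropped.
  avoiding-path : ∀ {e u v} → Avoiding e u v → AvoidingPath e u v
  avoiding-path ε = (ε , [] ∷ []) , []
  avoiding-path {u = u} ((f , f≢e , j) ◅ w) with avoiding-path w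
  ... | (w′ , unique) , avoid with any? (u Fin.≟_) (vertices w′)
  ...   | yes u∈w′ = path-from w′ unique avoid u∈w′
  ...   | no  u∉w′ = ((f , j) ◅ w′ , All.¬Any⇒All¬ _ u∉w′ ∷ unique) , f≢e ∷ avoid

  parallel : ∀ {e f u v} → Joins e u v → Joins f u v → f ≡ e
  parallel (inj₁ (p , q)) (inj₁ (r , s)) = simple (pair-≡ (trans r (sym p)) (trans s (sym q)))
  parallel (inj₂ (p , q)) (inj₂ (r , s)) = simple (pair-≡ (trans r (sym p)) (trans s (sym q)))
  parallel {e} {f} (inj₁ (p , q)) (inj₂ (r , s)) =
    ⊥-elim (antiparallel (ends e) (ends f) (trans p (sym s)) (trans q (sym r)))
  parallel {e} {f} (inj₂ (p , q)) (inj₁ (r , s)) =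
    ⊥-elim (antiparallel (ends e) (ends f) (trans p (sym s)) (trans q (sym r)))

  loop-free : ∀ {e u} → ¬ Joins e u u
  loop-free {e} j = irreflexive (ends e) (ends-equal j)
    where
    ends-equal : ∀ {u} → Joins e u u → Pair.fst (ends e) ≡ Pair.snd (ends e)
    ends-equal (inj₁ (p , q)) = trans p (sym q)
    ends-equal (inj₂ (p , q)) = trans p (sym q)

  start∈vertices : ∀ {u v} (w : Walk u v) → u ∈ vertices w
  start∈vertices ε       = here refl
  start∈vertices (_ ◅ _) = here refl

  end∈vertices : ∀ {e u v s t} (w : Walk s t) → e ∈ edges w → Joins e u v → u ∈ vertices w
  end∈vertices ((_ , inj₁ (p , q)) ◅ w) (here refl) (inj₁ (r , s)) = here (trans (sym r) p)
  end∈vertices ((_ , inj₂ (p , q)) ◅ w) (here refl) (inj₂ (r , s)) = here (trans (sym s) q)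
  end∈vertices ((_ , inj₁ (p , q)) ◅ w) (here refl) (inj₂ (r , s)) =
    there (subst (_∈ vertices w) (trans (sym q) s) (start∈vertices w))
  end∈vertices ((_ , inj₂ (p , q)) ◅ w) (here refl) (inj₁ (r , s)) =
    there (subst (_∈ vertices w) (trans (sym p) r) (start∈vertices w))
  end∈vertices (_ ◅ w) (there e∈w) j = there (end∈vertices w e∈w j)

  -- An occurrence of `e` on `w` would put its end `u` among the vertices of `w`.
  unique-edge : ∀ {e u v t} (w : Walk v t) → Joins e u v → All (u ≢_) (vertices w) → All (_≢ e) (edges w)
  unique-edge w j u∉w = All.¬Any⇒All¬ _ λ e∈w → All.All¬⇒¬Any u∉w (end∈vertices w (Any.map sym e∈w) j)

  unique-edges : ∀ {s t} (w : Walk s t) → Unique (vertices w) → Unique (edges w)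
  unique-edges ε             _              = []
  unique-edges ((e , j) ◅ w) (u∉w ∷ unique) = All.map ≢-sym (unique-edge w j u∉w) ∷ unique-edges w unique

  crosses : ∀ {e s t} → label e s ≢ label e t → (w : Walk s t) → e ∈ edges w
  crosses {e} l≢ w with any? (e Fin.≟_) (edges w)
  ... | yes e∈w = e∈w
  ... | no  e∉w = ⊥-elim (l≢ (label-walk w (All.map ≢-sym (All.¬Any⇒All¬ _ e∉w))))

  -- Separation in acyclic graphs

  module OfTree (acyclic : Acyclic) where

    -- Equal labels would give a path that joins the ends of `e` and avoids `e`. With no edge it
    -- makes `e` a loop, with one edge it is parallel to `e`, and with more edges it forms a cycle
    -- together with `e`.
    label-ends : ∀ {e u v} → Joins e u v → label e u ≢ label e v
    label-ends {e} j eq with avoiding-path (label-avoiding eq)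
    ... | (ε , _)                          , _          = loop-free j
    ... | ((f , j′) ◅ ε , _)               , f≢e ∷ _    = f≢e (parallel j j′)
    ... | (w@(_ ◅ _ ◅ w′) , unique)        , _          =
      acyclic (w , unique) (s≤s (s≤s (vertices-nonempty w′))) (e , Joins-sym j)
      where
      vertices-nonempty : ∀ {u v} (w : Walk u v) → 1 ≤ length (vertices w)
      vertices-nonempty ε       = s≤s z≤n
      vertices-nonempty (_ ◅ _) = s≤s z≤n

    -- Induction along the path. An edge other than `e` preserves the label. Once `e` is crossed,
    -- the rest of the path cannot return to it, so the label of `t` is that of the far end of `e`.
    label-path : ∀ {e s t} (w : Walk s t) → Unique (vertices w) → e ∈ edges w → label e s ≢ label e t
    label-path {e} ((f , j) ◅ w) (u∉w ∷ unique) e∈ eq with f Fin.≟ e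
    ... | yes refl = label-ends j (trans eq (sym (label-walk w (unique-edge w j u∉w))))
    ... | no  f≢e with e∈
    ...   | here e≡f  = f≢e (sym e≡f)
    ...   | there e∈w = label-path w unique e∈w (trans (sym (label-edge f≢e j)) eq)

    -- This is the form in which uniqueness of paths is used: every edge of `P` separates its ends
    -- and therefore lies on `Q`, and `P` repeats no edge.
    shortest : ∀ {s t} (θ : E → ℕ) (P Q : Path s t) →
               sum (List.map θ (edges (proj₁ P))) ≤ sum (List.map θ (edges (proj₁ Q)))
    shortest θ (w , unique) (w′ , _) =
      sum-⊆ θ (unique-edges w unique) λ e∈w → crosses (label-path w unique e∈w) w′

-- The optimal solution

module Selection (I : Instance) where

  open Instance I
  open Network network using (E; kind)
  open Labelling graph

  separates : E → Fin p → Bool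
  separates e i = not (does (label e (Pair.fst (terminals i)) Fin.≟ label e (Pair.snd (terminals i))))

  chosen : E → Bool
  chosen e = not (isSafe (kind e)) ∧ any (separates e) (allFin p)

  optimum : Subset m
  optimum = Vec.tabulate chosen

module Optimum (I : Instance) (isTree : OnTree I) where

  open Instance I
  open Network network using (Path; Walk; kind; θ; θ-positive; edges)
  open Graph.IsTree isTree
  open Labelling graph
  open OfTree acyclic
  open Selection I

  length-positive : ∀ {u v} (w : Walk u v) → u ≢ v → NonZero (sum (List.map θ (edges w)))
  length-positive ε             u≢u = ⊥-elim (u≢u refl)
  length-positive ((e , _) ◅ w) _   = >-nonZero (≤-trans (>-nonZero⁻¹ (θ e) {{θ-positive e}}) (m≤m+n (θ e) _))

  safe-upgraded : ∀ F e → isSafe (if lookup F e then safe else kind e) ≡ true → e Subset.∈ Network.Eₛ (network ⟨ F ⟩)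
  safe-upgraded F e eq = lookup⇒[]= e _ (trans (lookup∘tabulate _ e) eq)

  upgraded : ∀ F e → e Subset.∈ Network.Eₛ (network ⟨ F ⟩) → isSafe (kind e) ≡ false → lookup F e ≡ true
  upgraded F e e∈ unsafe-e with lookup F e | trans (sym (lookup∘tabulate _ e)) ([]=⇒lookup e∈)
  ... | true  | _  = refl
  ... | false | eq with () ← trans (sym eq) unsafe-e

  chosen-true : ∀ {e} i → isSafe (kind e) ≡ false →
                label e (Pair.fst (terminals i)) ≢ label e (Pair.snd (terminals i)) →
                chosen e ≡ true
  chosen-true {e} i unsafe-e l≢ rewrite unsafe-e =
    Equivalence.to T-≡ (Any.any⁺ (separates e) (lose (∈-allFin i)
      (Equivalence.from T-≡ (cong not (dec-false (_ Fin.≟ _) l≢)))))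

  chosen-separates : ∀ {e} → chosen e ≡ true → isSafe (kind e) ≡ false ×
                     ∃ λ i → label e (Pair.fst (terminals i)) ≢ label e (Pair.snd (terminals i))
  chosen-separates {e} eq with isSafe (kind e)
  ... | false with find (Any.any⁻ (separates e) (allFin p) (Equivalence.from T-≡ eq))
  ...   | i , _ , sep = refl , i , λ l≡ → subst T (cong not (dec-true (_ Fin.≟ _) l≡)) sep

  -- By `shortest` the path supplied by connectedness attains the distance itself, so the detour
  -- factor is a quotient of equal numbers. Its unsafe edges separate the pair and are thus chosen.
  optimum-connects : ∀ i → Connects optimum (terminals i)
  optimum-connects i = P , All.tabulate safe-edge , len-P , len≢0 , ((P , refl) , shortest θ P) ,
                       ℚ.≤-trans (ℚ.≤-reflexive (n/n≡1 len-P {{len≢0}})) 1≤α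
    where
    P : Path (Pair.fst (terminals i)) (Pair.snd (terminals i))
    P = connected _ _
    len-P = Network.len network P
    len≢0 : NonZero len-P
    len≢0 = length-positive (proj₁ P) (irreflexive (terminals i))
    safe-edge : ∀ {e} → e ∈ edges (proj₁ P) → e Subset.∈ Network.Eₛ (network ⟨ optimum ⟩)
    safe-edge {e} e∈P = safe-upgraded optimum e (upgraded-safe refl)
      where
      upgraded-safe : ∀ {b} → isSafe (kind e) ≡ b → isSafe (if lookup optimum e then safe else kind e) ≡ true
      upgraded-safe {true}  eq with lookup optimum e
      ... | true  = refl
      ... | false = eq
      upgraded-safe {false} eq rewrite trans (lookup∘tabulate chosen e)
        (chosen-true i eq (label-path (proj₁ P) (proj₂ P) e∈P)) = refl

  optimum-feasible : Feasible optimum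
  optimum-feasible = (λ {e} e∈ → x∉p⇒x∈∁p λ e∈Eₛ → contradictory
      (proj₁ (chosen-separates (trans (sym (lookup∘tabulate chosen e)) ([]=⇒lookup e∈))))
      (trans (sym (lookup∘tabulate _ e)) ([]=⇒lookup e∈Eₛ)))
    , optimum-connects
    where
    contradictory : ∀ {b} → b ≡ false → b ≡ true → ⊥
    contradictory refl ()

  -- Every walk between a pair separated by `e` crosses `e`, in particular the safe one; as `e` was
  -- unsafe, it must have been upgraded. Minimality then follows by comparing costs edge by edge.
  optimum-necessary : ∀ {F} → Feasible F → ∀ e → chosen e ≡ true → lookup F e ≡ true
  optimum-necessary {F} (_ , connects) e eq with chosen-separates eq
  ... | unsafe-e , i , l≢ with connects i
  ...   | (w , _) , safe-w , _ = upgraded F e (All.lookup safe-w (crosses l≢ w)) unsafe-e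

  optimum-minimal : ∀ F → Feasible F → cost optimum ≤ cost F
  optimum-minimal F feasible = sum-tabulate-mono _ _ λ e → cheaper e refl
    where
    cheaper : ∀ e {b} → chosen e ≡ b →
      (if lookup optimum e then costOf (kind e) else 0) ≤ (if lookup F e then costOf (kind e) else 0)
    cheaper e {true} eq rewrite trans (lookup∘tabulate chosen e) eq | optimum-necessary feasible e eq = ≤-refl
    cheaper e {false} eq rewrite trans (lookup∘tabulate chosen e) eq = z≤n

  solvable : Reflects HasSolution (does (cost optimum ≤? k))
  solvable = proof (map′ (λ cheap → optimum , cheap , optimum-feasible)
    (λ (F , cheap , feasible) → ≤-trans (optimum-minimal F feasible) cheap) (cost optimum ≤? k))

-- Computing the optimum

rootStep contractStep separatesStep : Term 4
rootᵗ contractᵗ separatesᵗ : Term 2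

rootStep = ite (app sameᵗ (var 1F ∷ hd (var 0F) ∷ [])) (tl (var 0F)) (var 1F)
rootᵗ    = foldrᵗ (var 1F) (var 0F) rootStep

contractStep = ite
  (ite (app sameᵗ (hd (hd (var 0F)) ∷ hd (hd (var 2F)) ∷ []))
       (app sameᵗ (tl (hd (var 0F)) ∷ tl (hd (var 2F)) ∷ []))
       nil)
  (var 1F)
  (cons (cons (app rootᵗ (tl (hd (var 0F)) ∷ var 1F ∷ [])) (app rootᵗ (hd (hd (var 0F)) ∷ var 1F ∷ []))) (var 1F))
contractᵗ = foldrᵗ (var 1F) nil contractStep

separatesStep = ite
  (app sameᵗ (app rootᵗ (hd (var 0F) ∷ var 2F ∷ []) ∷ app rootᵗ (tl (var 0F) ∷ var 2F ∷ []) ∷ []))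
  (var 1F)
  trueᵗ
separatesᵗ = foldrᵗ (var 1F) nil separatesStep

-- `encKind` yields `nil` exactly for safe edges, so the kind of an edge serves directly as the
-- condition.
chosenᵗ : Term 3
chosenᵗ = ite (hd (tl (var 0F))) (app separatesᵗ (app contractᵗ (var 0F ∷ var 1F ∷ []) ∷ var 2F ∷ [])) nil

edgesᵗ terminalsᵗ budgetᵗ : ∀ {Γ} → Term Γ → Term Γ
edgesᵗ i     = hd (tl i)
terminalsᵗ i = hd (tl (tl i))
budgetᵗ i    = hd (tl (tl (tl i)))

isChosenᵗ optimumStep costStep : Term 3
optimumᵗ costᵗ decisionᵗ : Term 1

isChosenᵗ = app chosenᵗ (var 0F ∷ edgesᵗ (var 2F) ∷ terminalsᵗ (var 2F) ∷ [])

optimumStep = cons isChosenᵗ (var 1F)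
optimumᵗ    = foldrᵗ (edgesᵗ (var 0F)) nil optimumStep

costStep = ite isChosenᵗ (app addᵗ (tl (hd (tl (var 0F))) ∷ var 1F ∷ [])) (var 1F)
costᵗ    = foldrᵗ (edgesᵗ (var 0F)) nil costStep

decisionᵗ = app leqᵗ (costᵗ ∷ budgetᵗ (var 0F) ∷ [])

-- Bounds by the size of the input

size-head : ∀ x → size (head x) ≤ size x
size-head nil     = ≤-refl
size-head (x ∙ y) = ≤-trans (m≤m+n (size x) (size y)) (n≤1+n _)

size-tail : ∀ x → size (tail x) ≤ size x
size-tail nil     = ≤-refl
size-tail (x ∙ y) = ≤-trans (m≤n+m (size y) (size x)) (n≤1+n _)

length≤size : ∀ xs → length xs ≤ size (encList xs)
length≤size []       = z≤n
length≤size (x ∷ xs) = s≤s (≤-trans (length≤size xs) (m≤n+m _ (size x)))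

member≤size : ∀ {x xs} → x ∈ xs → size x ≤ size (encList xs)
member≤size {x} (here refl) = ≤-trans (m≤m+n (size x) _) (n≤1+n _)
member≤size {xs = y ∷ xs} (there x∈xs) = ≤-trans (member≤size x∈xs) (≤-trans (m≤n+m _ (size y)) (n≤1+n _))

bits≤size : ∀ b → ℕᵇ.size b ≤ size (encBin b)
bits≤size ℕᵇ.zero  = z≤n
bits≤size 2[1+ b ] = s≤s (≤-trans (bits≤size b) (n≤1+n _))
bits≤size 1+[2 b ] = s≤s (≤-trans (bits≤size b) (m≤n+m _ 3))

toℕ<2^size : ∀ b → ℕᵇ.toℕ b < 2 ^ size (encBin b)
toℕ<2^size ℕᵇ.zero  = s≤s z≤n
toℕ<2^size 2[1+ b ] = ≤-<-trans (*-monoʳ-≤ 2 (toℕ<2^size b)) (^-monoʳ-< 2 ≤-refl {suc (size (encBin b))} ≤-refl)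
toℕ<2^size 1+[2 b ] = ≤-trans (≤-trans (≤-reflexive (sym (*-suc 2 (ℕᵇ.toℕ b)))) (*-monoʳ-≤ 2 (toℕ<2^size b)))
  (^-monoʳ-≤ 2 {suc (size (encBin b))} (m≤n+m _ 3))

-- The exponent follows `size (x ∙ y)`, so the bound passes from the entries of an encoded list to
-- the whole list.
+<2^ : ∀ {a b} s t → a < 2 ^ s → b < 2 ^ t → a + b < 2 ^ (1 + s + t)
+<2^ {a} {b} s t a< b< = begin-strict
  a + b                        <⟨ +-mono-< a< b< ⟩
  2 ^ s + 2 ^ t                ≤⟨ +-mono-≤ (^-monoʳ-≤ 2 (m≤m+n s t)) (^-monoʳ-≤ 2 (m≤n+m t s)) ⟩
  2 ^ (s + t) + 2 ^ (s + t)    ≡⟨ cong (2 ^ (s + t) +_) (+-identityʳ _) ⟨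
  2 ^ (1 + s + t)              ∎
  where open ≤-Reasoning

toList-tabulate : ∀ {A : Set} {k} (f : Fin k → A) → toList (Vec.tabulate f) ≡ List.tabulate f
toList-tabulate {k = zero}  f = refl
toList-tabulate {k = suc k} f = cong (f Fin.zero ∷_) (toList-tabulate (f ∘ Fin.suc))

sum-tabulate : ∀ {k} (f : Fin k → ℕ) → Vec.sum (Vec.tabulate f) ≡ sum (List.map f (allFin k))
sum-tabulate f = trans (go f) (cong sum (sym (map-tabulate (λ i → i) f)))
  where
  go : ∀ {k} (f : Fin k → ℕ) → Vec.sum (Vec.tabulate f) ≡ sum (List.tabulate f)
  go {zero}  f = refl
  go {suc k} f = cong (f Fin.zero +_) (go (f ∘ Fin.suc))

module Encoding (I : Instance) where

  open Instance I
  open Network network using (V; E; ends; kind; θ)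

  encEdge : E → Tree
  encEdge e = encPair (ends e) ∙ encKind (kind e) ∙ encℕ (θ e)

  encTerminals : Fin p → Tree
  encTerminals i = encPair (terminals i)

  encMerge : V × V → Tree
  encMerge (v , u) = encFin v ∙ encFin u

  encMerges : List (V × V) → Tree
  encMerges S = encList (List.map encMerge S)

  edgeCost : E → ℕ
  edgeCost e = costOf (kind e)

  input : Tree
  input = encInstance I

module SizeBounds (I : Instance) where

  open Instance I
  open Encoding I
  open Network network using (V; E; kind; θ; ends)

  length-tabulate≤ : ∀ {k} (f : Fin k → Tree) {N} → size (encList (List.tabulate f)) ≤ N → k ≤ N
  length-tabulate≤ f bound =
    ≤-trans (≤-reflexive (sym (length-tabulate f))) (≤-trans (length≤size (List.tabulate f)) bound)

  vertexList edgeList terminalList : Tree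
  vertexList   = encList (List.tabulate (encFin {n}))
  edgeList     = encList (List.tabulate encEdge)
  terminalList = encList (List.tabulate encTerminals)

  vertexList≤ : size vertexList ≤ size input
  vertexList≤ = size-head input

  edgeList≤ : size edgeList ≤ size input
  edgeList≤ = ≤-trans (size-head (tail input)) (size-tail input)

  terminalList≤ : size terminalList ≤ size input
  terminalList≤ = ≤-trans (size-head (tail (tail input))) (≤-trans (size-tail (tail input)) (size-tail input))

  m≤size : m ≤ size input
  m≤size = length-tabulate≤ encEdge edgeList≤

  p≤size : p ≤ size input
  p≤size = length-tabulate≤ encTerminals terminalList≤

  vertex≤size : ∀ (v : V) → ℕᵇ.size (ℕᵇ.fromℕ (toℕ v)) ≤ size input
  vertex≤size v = ≤-trans (bits≤size (ℕᵇ.fromℕ (toℕ v)))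
    (≤-trans (member≤size {encFin v} (∈-tabulate⁺ {f = encFin} v)) vertexList≤)

  edgeCost<2^size : ∀ e → edgeCost e < 2 ^ size (encEdge e)
  edgeCost<2^size e = ≤-trans (bound (kind e)) (^-monoʳ-≤ 2 (begin
      size (encKind (kind e))                            ≤⟨ m≤m+n _ _ ⟩
      size (encKind (kind e)) + size (encℕ (θ e))        ≤⟨ n≤1+n _ ⟩
      size (encKind (kind e) ∙ encℕ (θ e))               ≤⟨ m≤n+m _ (1 + size (encPair (ends e))) ⟩
      size (encEdge e)                                   ∎))
    where
    open ≤-Reasoning
    bound : ∀ κ → costOf κ < 2 ^ size (encKind κ)
    bound safe       = s≤s z≤n
    bound (unsafe c) = ≤-trans (subst (_< 2 ^ size (encℕ c)) (ℕᵇ.toℕ-fromℕ c) (toℕ<2^size (ℕᵇ.fromℕ c)))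
                         (^-monoʳ-≤ 2 (m≤n+m (size (encℕ c)) 2))

  -- Bounding the total over all edges covers every partial sum met while the cost of the optimum is
  -- added up, so no addition is cut off.
  costs<2^size : sum (List.map edgeCost (allFin m)) < 2 ^ size input
  costs<2^size = ≤-trans (go (allFin m)) (^-monoʳ-≤ 2
      (subst (λ l → size (encList l) ≤ size input) (sym (map-tabulate (λ e → e) encEdge)) edgeList≤))
    where
    go : ∀ es → sum (List.map edgeCost es) < 2 ^ size (encList (List.map encEdge es))
    go []       = s≤s z≤n
    go (e ∷ es) = +<2^ (size (encEdge e)) (size (encList (List.map encEdge es))) (edgeCost<2^size e) (go es)

-- Evaluation of the terms on encoded instances

module Evaluation (I : Instance) (N : ℕ) where

  open Instance I
  open Network network using (V; E; ends; kind; θ)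
  open Labelling graph
  open Encoding I
  open Selection I
  open Lists N
  open Comparison N
  open Addition N

  -- `N` remains a variable, and these four bounds are all that is assumed of it: they keep the
  -- folds over edges, terminal pairs, vertex numbers and costs from being cut off.
  module _ (m≤N : m ≤ N) (p≤N : p ≤ N) (vertex≤N : ∀ (v : V) → ℕᵇ.size (ℕᵇ.fromℕ (toℕ v)) ≤ N)
           (costs<2^N : sum (List.map edgeCost (allFin m)) < 2 ^ N) where

    encEdges : Tree
    encEdges = encList (List.tabulate encEdge)

    encEdges-map : encEdges ≡ encList (List.map encEdge (allFin m))
    encEdges-map = cong encList (sym (map-tabulate (λ e → e) encEdge))

    length-allFin : ∀ {k} → k ≤ N → length (allFin k) ≤ N
    length-allFin {k} k≤N = ≤-trans (≤-reflexive (length-tabulate {n = k} (λ i → i))) k≤N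

    length-map-allFin : ∀ {k} (f : Fin k → Tree) → k ≤ N → length (List.map f (allFin k)) ≤ N
    length-map-allFin {k} f k≤N = ≤-trans (≤-reflexive (length-map f (allFin k))) (length-allFin k≤N)

    eval-sameVertex : ∀ (u v : V) → eval N sameᵗ (encFin u ∷ encFin v ∷ []) ≡ encBool (does (u Fin.≟ v))
    eval-sameVertex u v = trans (eval-same (toℕ u) (toℕ v) (vertex≤N u) (vertex≤N v))
      (cong encBool (does-⇔ (mk⇔ toℕ-injective (cong toℕ)) (toℕ u ≟ toℕ v) (u Fin.≟ v)))

    eval-rootStep : ∀ q w ρ → eval N rootStep (encMerge q ∷ encFin w ∷ ρ) ≡ encFin (replace q w)
    eval-rootStep (v , u) w ρ = trans (cong (λ t → branch t (encFin u) (encFin w)) (eval-sameVertex w v))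
      (branch-if encFin (does (w Fin.≟ v)))

    eval-root : ∀ x S → length S ≤ N → eval N rootᵗ (encFin x ∷ encMerges S ∷ []) ≡ encFin (root x S)
    eval-root x S S≤N = trans
      (eval-foldr (var 1F) (var 0F) rootStep ρ (List.map encMerge S) refl
        (≤-trans (≤-reflexive (length-map encMerge S)) S≤N))
      (go S)
      where
      ρ : Vec Tree 2
      ρ = encFin x ∷ encMerges S ∷ []
      go : ∀ S → List.foldr (λ y a → eval N rootStep (y ∷ a ∷ ρ)) (encFin x) (List.map encMerge S) ≡ encFin (root x S)
      go []      = refl
      go (q ∷ S) = trans (cong (λ a → eval N rootStep (encMerge q ∷ a ∷ ρ)) (go S)) (eval-rootStep q (root x S) ρ)

    sameEnds : Tree → Tree → Tree
    sameEnds f e = branch (eval N sameᵗ (head (head f) ∷ head (head e) ∷ []))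
                          (eval N sameᵗ (tail (head f) ∷ tail (head e) ∷ [])) nil

    -- The encoding gives edges no index, so they are told apart by their ends, which is sound
    -- because the graph is simple.
    eval-sameEnds : ∀ f e → sameEnds (encEdge f) (encEdge e) ≡ encBool (does (f Fin.≟ e))
    eval-sameEnds f e = trans
      (cong₂ (λ s t → branch s t nil) (eval-sameVertex (Pair.fst (ends f)) (Pair.fst (ends e)))
                                       (eval-sameVertex (Pair.snd (ends f)) (Pair.snd (ends e))))
      (trans (branch-∧ (does (fst≟)) (does snd≟))
        (cong encBool (does-⇔ (mk⇔ (λ (p , q) → Graph.simple graph (pair-≡ p q)) λ { refl → refl , refl })
          (fst≟ ×-dec snd≟) (f Fin.≟ e))))
      where
      fst≟ = Pair.fst (ends f) Fin.≟ Pair.fst (ends e)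
      snd≟ = Pair.snd (ends f) Fin.≟ Pair.snd (ends e)

    eval-contractStep : ∀ e f S x → length S ≤ N →
      eval N contractStep (encEdge f ∷ encMerges S ∷ encEdge e ∷ x ∷ []) ≡
      encMerges (if does (f Fin.≟ e) then S else (root (Pair.snd (ends f)) S , root (Pair.fst (ends f)) S) ∷ S)
    eval-contractStep e f S x S≤N = trans
      (cong₂ (λ b t → branch b (encMerges S) (t ∙ encMerges S)) (eval-sameEnds f e)
        (cong₂ _∙_ (eval-root (Pair.snd (ends f)) S S≤N) (eval-root (Pair.fst (ends f)) S S≤N)))
      (branch-if encMerges (does (f Fin.≟ e)))

    eval-contract : ∀ e → eval N contractᵗ (encEdge e ∷ encEdges ∷ []) ≡ encMerges (contract e (allFin m))
    eval-contract e = trans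
      (eval-foldr (var 1F) nil contractStep ρ (List.map encEdge (allFin m))
        encEdges-map (length-map-allFin encEdge m≤N))
      (go (allFin m) (length-allFin m≤N))
      where
      ρ : Vec Tree 2
      ρ = encEdge e ∷ encEdges ∷ []
      go : ∀ fs → length fs ≤ N →
           List.foldr (λ y a → eval N contractStep (y ∷ a ∷ ρ)) nil (List.map encEdge fs) ≡ encMerges (contract e fs)
      go []       _   = refl
      go (f ∷ fs) f<N = trans (cong (λ a → eval N contractStep (encEdge f ∷ a ∷ ρ)) (go fs (<⇒≤ f<N)))
        (eval-contractStep e f (contract e fs) encEdges (≤-trans (length-contract e fs) (<⇒≤ f<N)))

    allTerminals : Tree
    allTerminals = encList (List.tabulate encTerminals)

    eval-separatesStep : ∀ e i b x →
      eval N separatesStep (encTerminals i ∷ encBool b ∷ encMerges (contract e (allFin m)) ∷ x ∷ []) ≡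
      encBool (separates e i ∨ b)
    eval-separatesStep e i b x = trans
      (cong (λ t → branch t (encBool b) (encBool true))
        (trans (cong₂ (λ u v → eval N sameᵗ (u ∷ v ∷ [])) (eval-root s S S≤N) (eval-root t S S≤N))
               (eval-sameVertex (label e s) (label e t))))
      (branch-not-∨ (does (label e s Fin.≟ label e t)))
      where
      s = Pair.fst (terminals i)
      t = Pair.snd (terminals i)
      S = contract e (allFin m)
      S≤N : length S ≤ N
      S≤N = ≤-trans (length-contract e (allFin m)) (length-allFin m≤N)
      branch-not-∨ : ∀ d → branch (encBool d) (encBool b) (encBool true) ≡ encBool (not d ∨ b)
      branch-not-∨ false = refl
      branch-not-∨ true  = refl

    eval-separates : ∀ e → eval N separatesᵗ (encMerges (contract e (allFin m)) ∷ allTerminals ∷ []) ≡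
                     encBool (any (separates e) (allFin p))
    eval-separates e = trans
      (eval-foldr (var 1F) nil separatesStep ρ (List.map encTerminals (allFin p))
        (cong encList (sym (map-tabulate (λ i → i) encTerminals))) (length-map-allFin encTerminals p≤N))
      (go (allFin p))
      where
      ρ : Vec Tree 2
      ρ = encMerges (contract e (allFin m)) ∷ allTerminals ∷ []
      go : ∀ is → List.foldr (λ y a → eval N separatesStep (y ∷ a ∷ ρ)) nil (List.map encTerminals is) ≡
                  encBool (any (separates e) is)
      go []       = refl
      go (i ∷ is) = trans (cong (λ a → eval N separatesStep (encTerminals i ∷ a ∷ ρ)) (go is))
        (eval-separatesStep e i (any (separates e) is) allTerminals)

    eval-chosen : ∀ e a → eval N isChosenᵗ (encEdge e ∷ a ∷ input ∷ []) ≡ encBool (chosen e)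
    eval-chosen e a = trans
      (cong (λ t → branch (encKind (kind e)) t nil)
        (trans (cong (λ S → eval N separatesᵗ (S ∷ allTerminals ∷ [])) (eval-contract e)) (eval-separates e)))
      (branch-kind (kind e))
      where
      branch-kind : ∀ κ {b} → branch (encKind κ) (encBool b) nil ≡ encBool (not (isSafe κ) ∧ b)
      branch-kind safe       = refl
      branch-kind (unsafe c) = refl

    eval-optimum : eval N optimumᵗ (input ∷ []) ≡ encSubset optimum
    eval-optimum = trans
      (eval-foldr (edgesᵗ (var 0F)) nil optimumStep ρ (List.map encEdge (allFin m))
        encEdges-map (length-map-allFin encEdge m≤N))
      (trans (go (allFin m)) (cong encList listed))
      where
      ρ : Vec Tree 1
      ρ = input ∷ []
      go : ∀ es → List.foldr (λ y a → eval N optimumStep (y ∷ a ∷ ρ)) nil (List.map encEdge es) ≡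
                  encList (List.map (encBool ∘ chosen) es)
      go []       = refl
      go (e ∷ es) = trans (cong (λ a → eval N optimumStep (encEdge e ∷ a ∷ ρ)) (go es))
        (cong (_∙ a) (eval-chosen e a))
        where a = encList (List.map (encBool ∘ chosen) es)
      listed : List.map (encBool ∘ chosen) (allFin m) ≡ List.map encBool (toList optimum)
      listed = trans (map-∘ (allFin m)) (cong (List.map encBool)
        (trans (map-tabulate (λ e → e) chosen) (sym (toList-tabulate chosen))))

    upgradeCost : E → ℕ
    upgradeCost e = if chosen e then edgeCost e else 0

    upgradeCosts≤ : ∀ es → sum (List.map upgradeCost es) ≤ sum (List.map edgeCost es)
    upgradeCosts≤ []       = z≤n
    upgradeCosts≤ (e ∷ es) = +-mono-≤ (if≤ (chosen e)) (upgradeCosts≤ es)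
      where
      if≤ : ∀ b {c} → (if b then c else 0) ≤ c
      if≤ false = z≤n
      if≤ true  = ≤-refl

    cost-optimum : cost optimum ≡ sum (List.map upgradeCost (allFin m))
    cost-optimum = trans
      (cong Vec.sum (tabulate-cong λ e → cong (λ b → if b then edgeCost e else 0) (lookup∘tabulate chosen e)))
      (sum-tabulate upgradeCost)

    eval-costStep : ∀ e a → edgeCost e + a < 2 ^ N →
      eval N costStep (encEdge e ∷ encℕ a ∷ input ∷ []) ≡ encℕ (upgradeCost e + a)
    eval-costStep e a small = trans
      (cong₂ (λ b t → branch b t (encℕ a)) (eval-chosen e (encℕ a))
        (trans (cong (λ c → eval N addᵗ (c ∷ encℕ a ∷ [])) (tail-encKind (kind e))) (eval-add (edgeCost e) a small)))
      (branch-+ (chosen e))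
      where
      -- For a safe edge this relies on `tail nil` being `nil`, which is also the encoding of 0.
      tail-encKind : ∀ κ → tail (encKind κ) ≡ encℕ (costOf κ)
      tail-encKind safe       = refl
      tail-encKind (unsafe c) = refl
      branch-+ : ∀ b {c} → branch (encBool b) (encℕ (c + a)) (encℕ a) ≡ encℕ ((if b then c else 0) + a)
      branch-+ false = refl
      branch-+ true  = refl

    eval-cost : eval N costᵗ (input ∷ []) ≡ encℕ (cost optimum)
    eval-cost = trans
      (eval-foldr (edgesᵗ (var 0F)) nil costStep ρ (List.map encEdge (allFin m))
        encEdges-map (length-map-allFin encEdge m≤N))
      (trans (go (allFin m) costs<2^N) (cong encℕ (sym cost-optimum)))
      where
      ρ : Vec Tree 1
      ρ = input ∷ []
      go : ∀ es → sum (List.map edgeCost es) < 2 ^ N →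
        List.foldr (λ y a → eval N costStep (y ∷ a ∷ ρ)) nil (List.map encEdge es) ≡
        encℕ (sum (List.map upgradeCost es))
      go []       _     = refl
      go (e ∷ es) small = trans
        (cong (λ a → eval N costStep (encEdge e ∷ a ∷ ρ)) (go es (≤-<-trans (m≤n+m _ (edgeCost e)) small)))
        (eval-costStep e (sum (List.map upgradeCost es))
          (≤-<-trans (+-monoʳ-≤ (edgeCost e) (upgradeCosts≤ es)) small))

    eval-decision : eval N decisionᵗ (input ∷ []) ≡ encBool (does (cost optimum ≤? k))
    eval-decision = trans (cong (λ c → eval N leqᵗ (c ∷ encℕ k ∷ [])) eval-cost)
      (eval-leq (cost optimum) k (size-fromℕ {cost optimum} {N}
        (≤-<-trans (≤-trans (≤-reflexive cost-optimum) (upgradeCosts≤ (allFin m))) costs<2^N)))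

proposition4 : PolyTimeSolvable encInstance OnTree MinCostOutput
    × PolyTimeSolvable encInstance OnTree DecisionOutput
proposition4 = polynomial-time-solvable optimumᵗ minimum , polynomial-time-solvable decisionᵗ decision
  where
  minimum : ∀ I → OnTree I → MinCostOutput I (eval (size (encInstance I)) optimumᵗ (encInstance I ∷ []))
  minimum I isTree = optimum , (optimum-feasible , optimum-minimal) ,
                     eval-optimum m≤size p≤size vertex≤size costs<2^size
    where
    open Selection I
    open Optimum I isTree
    open SizeBounds I
    open Evaluation I (size (encInstance I))
  decision : ∀ I → OnTree I → DecisionOutput I (eval (size (encInstance I)) decisionᵗ (encInstance I ∷ []))
  decision I isTree = does (cost optimum ≤? k) , solvable , eval-decision m≤size p≤size vertex≤size costs<2^size
    where
    open Instance I using (cost; k)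
    open Selection I
    open Optimum I isTree
    open SizeBounds I
    open Evaluation I (size (encInstance I))
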